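{- Let $p,n\in\mathbb N$ with $p\ge n\ge 10$ and $p=k(n-1)+n-6$ for some $k\in\mathbb N$. Then $$\mathrm{ex}(p;T_n^3)=\frac{(n-2)p-5(n-6)}2.$$
   Context: All graphs are finite simple graphs. For a graph $L$, $\mathrm{ex}(p;L)$ denotes the maximum number of edges in a graph on $p$ vertices that contains no subgraph isomorphic to $L$. For $n\ge 6$, $T_n^3$ is the tree on vertex set $\{v_0,\ldots,v_{n-1}\}$ with edge set $\{v_0v_1,v_0v_2,\ldots,v_0v_{n-4},\ v_1v_{n-3},\ v_1v_{n-2},\ v_1v_{n-1}\}$. $\mathbb N=\{1,2,\ldots\}$. -}

module Defs where

open import Data.Fin.Base using (Fin; toℕ)
open import Data.Fin.Properties using () renaming (_<?_ to _<ᶠ?_)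
open import Data.List.Base using (List; length; filter; allFin; cartesianProduct)
open import Data.Nat.Base using (ℕ; suc; _∸_; _≤_; _≥_; z≤n; s≤s)
open import Data.Nat.Properties using (_≤?_)
open import Data.Product.Base using (Σ-syntax; _×_; _,_)
open import Data.Sum.Base using (_⊎_; inj₁; inj₂; swap)
open import Function.Definitions using (Injective)
open import Level using (0ℓ)
open import Relation.Binary.Core using (Rel)
open import Relation.Binary.Definitions using (Symmetric; Irreflexive; Decidable)
open import Relation.Binary.PropositionalEquality.Core using (_≡_; refl)
open import Relation.Nullary using (¬_; yes; no)
open import Relation.Nullary.Decidable using (_×-dec_; _⊎-dec_)

record Graph (p : ℕ) : Set₁ where
  infix 4 _~_ _~?_
  field
    _~_      : Rel (Fin p) 0ℓ
    ~-sym    : Symmetric _~_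
    ~-irrefl : Irreflexive _≡_ _~_
    -- Needed to count edges.
    _~?_     : Decidable _~_

-- An edge {i , j} is listed once, as the pair with i < j.
edges : ∀ {p} → Graph p → List (Fin p × Fin p)
edges {p} G = filter (λ (i , j) → (i <ᶠ? j) ×-dec (i ~? j))
                     (cartesianProduct (allFin p) (allFin p))
  where open Graph G

e : ∀ {p} → Graph p → ℕ
e G = length (edges G)

-- G has a (not necessarily induced) subgraph isomorphic to L: the image of
-- the vertices and edges of L under f.
Contains : ∀ {p n} → Graph p → Graph n → Set
Contains {p} {n} G L =
  Σ[ f ∈ (Fin n → Fin p) ] Injective _≡_ _≡_ f × (∀ {i j} → i L.~ j → f i G.~ f j)
  where
  module G = Graph G
  module L = Graph L

-- "ex(p;L) = m".  A relation rather than a function, because the maximum does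
-- not exist when every graph on p vertices contains L (e.g. L edgeless, n ≤ p).
IsEx : ∀ {n} → ℕ → Graph n → ℕ → Set₁
IsEx p L m = (Σ[ G ∈ Graph p ] ¬ Contains G L × e G ≡ m)
           × (∀ (G : Graph p) → ¬ Contains G L → e G ≤ m)

-- The edges v_i v_j of T³ₙ with i < j, for vertex indices i, j < n.
data T³Edge (n : ℕ) : ℕ → ℕ → Set where
  v₀v : ∀ {j} → 1 ≤ j → j ≤ n ∸ 4 → T³Edge n 0 j
  v₁v : ∀ {j} → n ∸ 3 ≤ j → j ≤ n ∸ 1 → T³Edge n 1 j

T³Edge? : ∀ n → Decidable (T³Edge n)
T³Edge? n 0 j with 1 ≤? j | j ≤? n ∸ 4
... | yes a | yes b = yes (v₀v a b)
... | no ¬a | _     = no λ { (v₀v a _) → ¬a a }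
... | _     | no ¬b = no λ { (v₀v _ b) → ¬b b }
T³Edge? n 1 j with n ∸ 3 ≤? j | j ≤? n ∸ 1
... | yes a | yes b = yes (v₁v a b)
... | no ¬a | _     = no λ { (v₁v a _) → ¬a a }
... | _     | no ¬b = no λ { (v₁v _ b) → ¬b b }
T³Edge? n (suc (suc i)) j = no λ ()

T³Edge-irrefl : ∀ {n i} → n ≥ 6 → ¬ T³Edge n i i
T³Edge-irrefl _ (v₀v () _)
T³Edge-irrefl (s≤s (s≤s (s≤s (s≤s (s≤s (s≤s _)))))) (v₁v (s≤s ()) _)

T³ : ∀ n → n ≥ 6 → Graph n
T³ n n≥6 = record
  { _~_      = λ i j → T³Edge n (toℕ i) (toℕ j) ⊎ T³Edge n (toℕ j) (toℕ i)
  ; ~-sym    = swap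
  ; ~-irrefl = λ { refl (inj₁ x) → T³Edge-irrefl n≥6 x
                 ; refl (inj₂ x) → T³Edge-irrefl n≥6 x }
  ; _~?_     = λ i j → T³Edge? n (toℕ i) (toℕ j) ⊎-dec T³Edge? n (toℕ j) (toℕ i)
  }

{-# OPTIONS --safe #-}
module Submission where

-- Put N = n − 1.  For a vertex set S the deficit (N − 1)|S| − Σ_{x ∈ S} deg_S x is bounded below by
-- peeling off, one after the other, sets A of vertices.  If u is adjacent to v, deg v ≥ N − k and
-- deg u ≥ 4, then in a T³-free graph u has fewer than k neighbours outside the closed ball of v; so
-- such balls have few outgoing edges, and peeling one of them (or a union of two) of size N or N − 1
-- costs no more than peeling a clique of that size.  Vertices of degree ≥ N have only neighbours of
-- degree ≤ 3 and are peeled off together with all these.  What remains has at most N vertices or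
-- maximal degree ≤ N − 3.  A residue r of the vertex number modulo N contributes r (N − r), and s
-- vertices outside of the periodic part contribute 2s, which gives at least 5 (N − 5) when
-- |S| ≡ N − 5, except if s = 2N − 5 and r = 0; in that case a finer count of the vertices of
-- degree N − 3 is needed.

open import Defs
open import Data.Bool.Base using (Bool; true; false; _∧_; _∨_; not)
open import Data.Bool.Properties using (¬-not) renaming (_≟_ to _≟ᵇ_)
open import Data.Fin.Base using (Fin; zero; suc; toℕ; cast; fromℕ<)
open import Data.Fin.Properties using (any?; toℕ-cast; toℕ-injective; toℕ-fromℕ<; toℕ<n; injective⇒≤)
  renaming (_≟_ to _≟ᶠ_; _<?_ to _<ᶠ?_; <-cmp to <ᶠ-cmp)
open import Data.List.Base using (List; []; _∷_; _++_; length; lookup; map; filter; tabulate; cartesianProduct)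
open import Data.List.Membership.DecPropositional using (_∈?_)
open import Data.List.Membership.Propositional using (_∈_; _∉_)
open import Data.List.Membership.Propositional.Properties using (∈-lookup; ∈-++⁻)
open import Data.List.Properties using (length-++; filter-++)
open import Data.List.Relation.Unary.All as All using (All; []; _∷_)
open import Data.List.Relation.Unary.All.Properties as All using ()
open import Data.List.Relation.Unary.AllPairs using ([]; _∷_)
open import Data.List.Relation.Unary.Any using (here; there)
open import Data.List.Relation.Unary.Unique.Propositional using (Unique)
open import Data.List.Relation.Unary.Unique.Propositional.Properties as Unique using ()
open import Data.Nat.Base
open import Data.Nat.DivMod
  using (m≡m%n+[m/n]*n; m%n<n; m<n⇒m%n≡m; m<n⇒m/n≡0; m*n/n≡m; +-distrib-/-∣ˡ; [m+n]%n≡m%n)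
open import Data.Nat.Divisibility using (n∣m*n)
open import Data.Nat.Induction using (<-rec)
open import Data.Nat.Properties
open import Algebra.Properties.Semiring.Sum +-*-semiring
  using (sum; ∑-distrib-+; ∑-comm; sum-cong-≗; *-distribʳ-sum; *-distribˡ-sum)
open import Data.Nat.Tactic.RingSolver using (solve-∀)
open import Data.Product.Base using (∃-syntax; _×_; _,_; proj₁; proj₂)
open import Data.Sum.Base using (_⊎_; inj₁; inj₂; [_,_]′)
open import Function.Base using (_∘_; id)
open import Level using (0ℓ)
open import Relation.Binary.Definitions using (tri<; tri≈; tri>)
open import Relation.Binary.PropositionalEquality.Core
open import Relation.Binary.PropositionalEquality.Properties using (module ≡-Reasoning)
open import Relation.Nullary using (¬_; Dec; yes; no; does; contradiction)
open import Relation.Nullary.Decidable using (dec-true; dec-false; _×-dec_; ¬?)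
open import Relation.Unary using (Pred; Decidable)

-- Counting in finite sets

-- The reference value comes from k copies of K_N and one K_{N-5}: a clique component of size r has
-- deficit r (N - r), so this graph has deficit exactly 5 (N - 5). The pieces peeled off a general
-- graph are not cliques, and their sizes need not follow this partition. The bound survives because
-- r (N - r), read modulo N, is subadditive: all clique-like pieces merge into a single residue.
-- Pieces that gain only a fixed amount per vertex do not merge in this way and are recorded apart.
-- In the exceptional case 2s falls short of 5 (N - 5) by N - 15, so it is harmless up to N = 15.
-- Beyond that, the missing N - 15 has to come from vertices whose degree is below N - 3. One use of
-- n ≥ 10 is at the vertices of degree at least N: peeling them with their neighbours costs at most
-- 6 of the available N - 1 per vertex, which leaves N - 7 ≥ 2.

⟦_⟧ : Bool → ℕ
⟦ true ⟧  = 1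
⟦ false ⟧ = 0

∧⁻ : ∀ {a b} → a ∧ b ≡ true → a ≡ true × b ≡ true
∧⁻ {true} {true} refl = refl , refl

∧⁺ : ∀ {a b} → a ≡ true → b ≡ true → a ∧ b ≡ true
∧⁺ refl refl = refl

does⁻ : ∀ {A : Set} (d : Dec A) → does d ≡ true → A
does⁻ (yes a) _ = a

≤-by : ∀ {a b} c → a + c ≡ b → a ≤ b
≤-by {a} c refl = m≤m+n a c

sum-mono : ∀ {p} {f g : Fin p → ℕ} → (∀ x → f x ≤ g x) → sum f ≤ sum g
sum-mono {zero}  h = z≤n
sum-mono {suc p} h = +-mono-≤ (h zero) (sum-mono (h ∘ suc))

Subset : ℕ → Set
Subset p = Fin p → Bool

module _ {p : ℕ} where

  infixl 6 _∩_
  infixl 5 _∪_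
  infixl 7 _∖_

  _∩_ _∪_ : Subset p → Subset p → Subset p
  (A ∩ B) x = A x ∧ B x
  (A ∪ B) x = A x ∨ B x

  ∁_ : Subset p → Subset p
  (∁ A) x = not (A x)

  infix 8 ∁_

  _∖_ : Subset p → List (Fin p) → Subset p
  (A ∖ zs) x = A x ∧ not (does (_∈?_ _≟ᶠ_ x zs))

  sumOn : Subset p → (Fin p → ℕ) → ℕ
  sumOn A f = sum (λ x → ⟦ A x ⟧ * f x)

  count : Subset p → ℕ
  count A = sum (λ x → ⟦ A x ⟧)

  sumOn-mono : ∀ A {f g} → (∀ x → A x ≡ true → f x ≤ g x) → sumOn A f ≤ sumOn A g
  sumOn-mono A {f} {g} h = sum-mono pt
    where
    pt : ∀ x → ⟦ A x ⟧ * f x ≤ ⟦ A x ⟧ * g x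
    pt x with A x in eq
    ... | true  = +-monoˡ-≤ 0 (h x eq)
    ... | false = z≤n

  sumOn-const : ∀ A c → sumOn A (λ _ → c) ≡ count A * c
  sumOn-const A c = sym (*-distribʳ-sum c (λ x → ⟦ A x ⟧))

  sumOn-≤ : ∀ A {f} c → (∀ x → A x ≡ true → f x ≤ c) → sumOn A f ≤ count A * c
  sumOn-≤ A c h = ≤-trans (sumOn-mono A h) (≤-reflexive (sumOn-const A c))

  sumOn-+ : ∀ A f g → sumOn A (λ x → f x + g x) ≡ sumOn A f + sumOn A g
  sumOn-+ A f g = trans (sum-cong-≗ (λ x → *-distribˡ-+ ⟦ A x ⟧ (f x) (g x)))
                        (∑-distrib-+ (λ x → ⟦ A x ⟧ * f x) (λ x → ⟦ A x ⟧ * g x))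

  sumOn-indicator : ∀ A B c → sumOn A (λ x → ⟦ B x ⟧ * c) ≡ count (A ∩ B) * c
  sumOn-indicator A B c = trans (sum-cong-≗ pt) (sumOn-const (A ∩ B) c)
    where
    pt : ∀ x → ⟦ A x ⟧ * (⟦ B x ⟧ * c) ≡ ⟦ A x ∧ B x ⟧ * c
    pt x with A x
    ... | true  = +-identityʳ _
    ... | false = refl

  count-mono : ∀ {A B} → (∀ x → A x ≡ true → B x ≡ true) → count A ≤ count B
  count-mono {A} {B} h = sum-mono pt
    where
    pt : ∀ x → ⟦ A x ⟧ ≤ ⟦ B x ⟧
    pt x with A x in eq
    ... | true  rewrite h x eq = ≤-refl
    ... | false = z≤n

  count-cong : ∀ {A B} → (∀ x → A x ≡ B x) → count A ≡ count B
  count-cong h = sum-cong-≗ (λ x → cong ⟦_⟧ (h x))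

  count-split : ∀ A B → count A ≡ count (A ∩ B) + count (A ∩ ∁ B)
  count-split A B = trans (sum-cong-≗ pt) (∑-distrib-+ (λ x → ⟦ (A ∩ B) x ⟧) (λ x → ⟦ (A ∩ ∁ B) x ⟧))
    where
    pt : ∀ x → ⟦ A x ⟧ ≡ ⟦ (A ∩ B) x ⟧ + ⟦ (A ∩ ∁ B) x ⟧
    pt x with A x | B x
    ... | true  | true  = refl
    ... | true  | false = refl
    ... | false | _     = refl

  count-empty : ∀ (A : Subset p) → (∀ x → A x ≡ false) → count A ≡ 0
  count-empty A h = trans (count-cong h) (sum-zero p)
    where
    sum-zero : ∀ n → sum {n} (λ _ → 0) ≡ 0
    sum-zero zero    = refl
    sum-zero (suc n) = sum-zero n

  count⇒∃ : ∀ A → 1 ≤ count A → ∃[ x ] A x ≡ true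
  count⇒∃ A 1≤ with any? (λ x → A x ≟ᵇ true)
  ... | yes x∈A = x∈A
  ... | no  ∄   = contradiction (subst (1 ≤_) (count-empty A (λ x → ¬-not (λ e → ∄ (x , e)))) 1≤) λ ()

count-singleton : ∀ {p} (z : Fin p) → count (λ x → does (x ≟ᶠ z)) ≡ 1
count-singleton {suc p} zero = cong suc (count-empty {p} (λ _ → false) (λ _ → refl))
count-singleton (suc z) = count-singleton z

count-full : ∀ p → count {p} (λ _ → true) ≡ p
count-full zero    = refl
count-full (suc p) = cong suc (count-full p)

module _ {p : ℕ} where

  ∃⇒count : ∀ (A : Subset p) x → A x ≡ true → 1 ≤ count A
  ∃⇒count A x x∈A = subst (_≤ count A) (count-singleton x) (count-mono sub)
    where
    sub : ∀ y → does (y ≟ᶠ x) ≡ true → A y ≡ true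
    sub y e rewrite does⁻ (y ≟ᶠ x) e = x∈A

  count-∖ : ∀ zs (A : Subset p) → count A ≤ count (A ∖ zs) + length zs
  count-∖ zs A = begin
    count A                                   ≤⟨ sum-mono pt ⟩
    sum (λ x → ⟦ (A ∖ zs) x ⟧ + ⟦ mem zs x ⟧) ≡⟨ ∑-distrib-+ (λ x → ⟦ (A ∖ zs) x ⟧) (λ x → ⟦ mem zs x ⟧) ⟩
    count (A ∖ zs) + count (mem zs)           ≤⟨ +-monoʳ-≤ (count (A ∖ zs)) (count-mem zs) ⟩
    count (A ∖ zs) + length zs                ∎
    where
    open ≤-Reasoning
    mem : List (Fin p) → Subset p
    mem zs x = does (_∈?_ _≟ᶠ_ x zs)
    pt : ∀ x → ⟦ A x ⟧ ≤ ⟦ (A ∖ zs) x ⟧ + ⟦ mem zs x ⟧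
    pt x with A x | mem zs x
    ... | true  | true  = ≤-refl
    ... | true  | false = ≤-refl
    ... | false | _     = z≤n
    count-mem : ∀ zs → count (mem zs) ≤ length zs
    count-mem []       = ≤-reflexive (count-empty (mem []) (λ _ → refl))
    count-mem (z ∷ zs) = begin
      count (mem (z ∷ zs))                         ≤⟨ sum-mono pt′ ⟩
      sum (λ x → ⟦ does (x ≟ᶠ z) ⟧ + ⟦ mem zs x ⟧) ≡⟨ ∑-distrib-+ (λ x → ⟦ does (x ≟ᶠ z) ⟧) (λ x → ⟦ mem zs x ⟧) ⟩
      count (λ x → does (x ≟ᶠ z)) + count (mem zs) ≤⟨ +-mono-≤ (≤-reflexive (count-singleton z)) (count-mem zs) ⟩
      suc (length zs)                              ∎
      where
      pt′ : ∀ x → ⟦ does (x ≟ᶠ z) ∨ mem zs x ⟧ ≤ ⟦ does (x ≟ᶠ z) ⟧ + ⟦ mem zs x ⟧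
      pt′ x with does (x ≟ᶠ z)
      ... | true  = s≤s z≤n
      ... | false = ≤-refl

  ∖⁻ : ∀ (A : Subset p) zs {x} → (A ∖ zs) x ≡ true → A x ≡ true × x ∉ zs
  ∖⁻ A zs {x} e with A x | _∈?_ _≟ᶠ_ x zs
  ... | true | no x∉zs = refl , x∉zs

  choose : ∀ k (A : Subset p) → k ≤ count A →
           ∃[ xs ] length xs ≡ k × Unique xs × All (λ x → A x ≡ true) xs
  choose zero    A _ = [] , refl , [] , []
  choose (suc k) A k<
    with x , x∈A ← count⇒∃ A (≤-trans (s≤s z≤n) k<)
    with xs , len , uniq , all ← choose k (A ∖ (x ∷ []))
           (+-cancelʳ-≤ 1 _ _ (subst (_≤ count (A ∖ (x ∷ [])) + 1) (+-comm 1 k)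
                                     (≤-trans k< (count-∖ (x ∷ []) A))))
    = x ∷ xs , cong suc len
    , All.map (λ y∈ x≡y → proj₂ (∖⁻ A (x ∷ []) y∈) (here (sym x≡y))) all ∷ uniq
    , x∈A ∷ All.map (λ y∈ → proj₁ (∖⁻ A (x ∷ []) y∈)) all

-- Finding copies of T³

lookup-injective : ∀ {A : Set} {xs : List A} → Unique xs → ∀ {i j} → lookup xs i ≡ lookup xs j → i ≡ j
lookup-injective (x∉ ∷ u) {zero}  {zero}  _ = refl
lookup-injective (x∉ ∷ u) {zero}  {suc j} e = contradiction e (All.lookup x∉ (∈-lookup j))
lookup-injective (x∉ ∷ u) {suc i} {zero}  e = contradiction (sym e) (All.lookup x∉ (∈-lookup i))
lookup-injective (x∉ ∷ u) {suc i} {suc j} e = cong suc (lookup-injective u e)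

module _ {A : Set} {P : A → Set} where

  lookup-++ˡ : ∀ {xs ys} → All P xs → (i : Fin (length (xs ++ ys))) → toℕ i < length xs →
               P (lookup (xs ++ ys) i)
  lookup-++ˡ (px ∷ _)  zero    _       = px
  lookup-++ˡ (_ ∷ pxs) (suc i) (s≤s i<) = lookup-++ˡ pxs i i<

  lookup-++ʳ : ∀ xs {ys} → All P ys → (i : Fin (length (xs ++ ys))) → length xs ≤ toℕ i →
               P (lookup (xs ++ ys) i)
  lookup-++ʳ []       pys i       _        = All.lookup pys (∈-lookup i)
  lookup-++ʳ (_ ∷ xs) pys (suc i) (s≤s ≤i) = lookup-++ʳ xs pys i ≤i

adj : ∀ {p} → Graph p → Fin p → Fin p → Bool
adj G x y = does (Graph._~?_ G x y)

-- The order of `v ∷ u ∷ ys ++ xs` is the numbering of the tree, so an index is a list position: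
-- `ys` supplies v₂ up to v_{n-4} and `xs` the last three vertices.
embed-T³ : ∀ M {p} (G : Graph p) (n≥6 : 10 + M ≥ 6) v u ys xs →
           length ys ≡ 5 + M → length xs ≡ 3 → Unique (v ∷ u ∷ ys ++ xs) →
           All (λ y → adj G v y ≡ true) (u ∷ ys) → All (λ x → adj G u x ≡ true) xs →
           Contains G (T³ (10 + M) n≥6)
embed-T³ M {p} G n≥6 v u ys xs |ys| |xs| uniq vN uN = f , f-inj , [ edge′ , ~-sym ∘ edge′ ]′
  where
  open Graph G
  vs : List (Fin p)
  vs = v ∷ u ∷ ys ++ xs
  |vs| : 10 + M ≡ length vs
  |vs| = sym (trans (cong (2 +_) (trans (length-++ ys) (cong₂ _+_ |ys| |xs|))) (arith M))
    where
    arith : ∀ m → 2 + (5 + m + 3) ≡ 10 + m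
    arith = solve-∀
  f : Fin (10 + M) → Fin p
  f i = lookup vs (cast |vs| i)
  f-inj : ∀ {i j} → f i ≡ f j → i ≡ j
  f-inj {i} {j} e = toℕ-injective (trans (sym (toℕ-cast |vs| i))
    (trans (cong toℕ (lookup-injective uniq {cast |vs| i} {cast |vs| j} e)) (toℕ-cast |vs| j)))
  edge : ∀ {a b} → T³Edge (10 + M) a b → (i j : Fin (length vs)) → toℕ i ≡ a → toℕ j ≡ b →
         adj G (lookup vs i) (lookup vs j) ≡ true
  edge (v₀v 1≤b b≤) zero (suc j) refl refl =
    lookup-++ˡ vN j (≤-trans b≤ (≤-reflexive (cong suc (sym |ys|))))
  edge (v₁v ≤b b≤) (suc zero) j refl refl =
    lookup-++ʳ (v ∷ u ∷ ys) uN j (≤-trans (≤-reflexive (cong (2 +_) |ys|)) ≤b)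
  edge′ : ∀ {i j} → T³Edge (10 + M) (toℕ i) (toℕ j) → f i ~ f j
  edge′ {i} {j} t = does⁻ (_ ~? _) (edge t (cast |vs| i) (cast |vs| j) (toℕ-cast |vs| i) (toℕ-cast |vs| j))

module _ {p : ℕ} (a : Fin p → Fin p → Bool) where

  nbhd : Subset p → Fin p → Subset p
  nbhd S x y = S y ∧ a x y

  deg : Subset p → Fin p → ℕ
  deg S x = count (nbhd S x)

  closedNbhd : Fin p → Subset p
  closedNbhd v y = does (y ≟ᶠ v) ∨ a v y

  out : Subset p → Fin p → Fin p → ℕ
  out S v u = count (nbhd S u ∩ ∁ (closedNbhd v))

∨-false : ∀ {a b} → not (a ∨ b) ≡ true → a ≡ false × b ≡ false
∨-false {false} {false} refl = refl , refl

adj⇒≢ : ∀ {p} (G : Graph p) {x z} → adj G x z ≡ true → x ≢ z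
adj⇒≢ G e q = Graph.~-irrefl G q (does⁻ (Graph._~?_ G _ _) e)

-- Let `v` be v₀ and `u` be v₁. Take k leaves of `u` outside the ball of `v`; degree 4 leaves 3 - k
-- further ones besides `v`. Only these 3 - k and `u` itself can be lost as neighbours of `v`, so
-- degree N - k still leaves the N - 4 leaves that v₀ needs.
T³-free⇒ : ∀ M {p} (G : Graph p) (n≥6 : 10 + M ≥ 6) → ¬ Contains G (T³ (10 + M) n≥6) →
           ∀ S v u k → k ≤ 3 → adj G v u ≡ true → 4 ≤ deg (adj G) S u →
           9 + M ≤ deg (adj G) S v + k → ¬ k ≤ out (adj G) S v u
T³-free⇒ M {p} G n≥6 free S v u k k≤3 v~u 4≤ ≤deg k≤ =
  let x₁ , |x₁| , u₁ , all₁ = choose k X₁ k≤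
      x₂ , |x₂| , u₂ , all₂ = choose (3 ∸ k) (X₂ x₁) (|X₂| x₁ |x₁|)
      ys , |ys| , u₃ , all₃ = choose (5 + M) (Y x₂) (|Y| x₂ |x₂|)
  in free (copy x₁ x₂ ys |x₁| |x₂| |ys| u₁ u₂ u₃ all₁ all₂ all₃)
  where
  open ≤-Reasoning
  a = adj G
  X₁ : Subset p
  X₁ = nbhd a S u ∩ ∁ closedNbhd a v
  X₂ Y : List (Fin p) → Subset p
  X₂ x₁ = nbhd a S u ∖ (v ∷ x₁)
  Y  x₂ = nbhd a S v ∖ (u ∷ x₂)

  X₁⇒ : ∀ {z} → X₁ z ≡ true → a u z ≡ true × z ≢ v × a v z ≡ false
  X₁⇒ {z} q with ∧⁻ {S z ∧ a u z} q
  ... | Su , ¬v with ∧⁻ {S z} Su | z ≟ᶠ v | ∨-false {does (z ≟ᶠ v)} ¬v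
  ...   | _ , u~z | no z≢v | _ , v≁z = u~z , z≢v , v≁z
  X₂⇒ : ∀ x₁ {z} → X₂ x₁ z ≡ true → a u z ≡ true × z ∉ v ∷ x₁
  X₂⇒ x₁ {z} q with ∖⁻ (nbhd a S u) (v ∷ x₁) q
  ... | Su , z∉ = proj₂ (∧⁻ {S z} Su) , z∉
  Y⇒ : ∀ x₂ {z} → Y x₂ z ≡ true → a v z ≡ true × z ∉ u ∷ x₂
  Y⇒ x₂ {z} q with ∖⁻ (nbhd a S v) (u ∷ x₂) q
  ... | Sv , z∉ = proj₂ (∧⁻ {S z} Sv) , z∉

  |X₂| : ∀ x₁ → length x₁ ≡ k → 3 ∸ k ≤ count (X₂ x₁)
  |X₂| x₁ refl = +-cancelʳ-≤ (suc k) _ _ (begin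
    3 ∸ k + suc k           ≡⟨ trans (+-suc (3 ∸ k) k) (cong suc (m∸n+n≡m k≤3)) ⟩
    4                       ≤⟨ 4≤ ⟩
    deg a S u               ≤⟨ count-∖ (v ∷ x₁) (nbhd a S u) ⟩
    count (X₂ x₁) + suc k   ∎)

  |Y| : ∀ x₂ → length x₂ ≡ 3 ∸ k → 5 + M ≤ count (Y x₂)
  |Y| x₂ |x₂| = +-cancelʳ-≤ 4 _ _ (begin
    5 + M + 4                             ≡⟨ +-comm (5 + M) 4 ⟩
    9 + M                                 ≤⟨ ≤deg ⟩
    deg a S v + k                         ≤⟨ +-monoˡ-≤ k (count-∖ (u ∷ x₂) (nbhd a S v)) ⟩
    count (Y x₂) + suc (length x₂) + k    ≡⟨ +-assoc (count (Y x₂)) _ k ⟩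
    count (Y x₂) + suc (length x₂ + k)    ≡⟨ cong (λ l → count (Y x₂) + suc l)
                                               (trans (cong (_+ k) |x₂|) (m∸n+n≡m k≤3)) ⟩
    count (Y x₂) + 4                      ∎)

  disjoint₁₂ : ∀ x₁ {x₂} → All (λ z → X₂ x₁ z ≡ true) x₂ → ∀ {z} → ¬ (z ∈ x₁ × z ∈ x₂)
  disjoint₁₂ x₁ all₂ (z∈₁ , z∈₂) = proj₂ (X₂⇒ x₁ (All.lookup all₂ z∈₂)) (there z∈₁)

  disjoint-y : ∀ x₁ x₂ {ys} → All (λ z → X₁ z ≡ true) x₁ → All (λ z → Y x₂ z ≡ true) ys →
               ∀ {z} → ¬ (z ∈ ys × z ∈ x₁ ++ x₂)
  disjoint-y x₁ x₂ all₁ all₃ (z∈y , z∈x) with ∈-++⁻ x₁ z∈x | Y⇒ x₂ (All.lookup all₃ z∈y)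
  ... | inj₂ z∈₂ | _ , z∉   = z∉ (there z∈₂)
  ... | inj₁ z∈₁ | v~z , _ with X₁⇒ (All.lookup all₁ z∈₁)
  ...   | _ , _ , v≁z = contradiction (trans (sym v~z) v≁z) λ ()

  copy : ∀ x₁ x₂ ys → length x₁ ≡ k → length x₂ ≡ 3 ∸ k → length ys ≡ 5 + M →
         Unique x₁ → Unique x₂ → Unique ys → All (λ z → X₁ z ≡ true) x₁ →
         All (λ z → X₂ x₁ z ≡ true) x₂ → All (λ z → Y x₂ z ≡ true) ys → Contains G (T³ (10 + M) n≥6)
  copy x₁ x₂ ys |x₁| |x₂| |ys| u₁ u₂ u₃ all₁ all₂ all₃
    = embed-T³ M G n≥6 v u ys (x₁ ++ x₂) |ys|
        (trans (length-++ x₁) (trans (cong₂ _+_ |x₁| |x₂|) (m+[n∸m]≡n k≤3)))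
        ((adj⇒≢ G v~u ∷ All.++⁺ (All.map (λ q → adj⇒≢ G (proj₁ (Y⇒ x₂ q))) all₃)
                          (All.++⁺ (All.map (λ q → proj₁ (proj₂ (X₁⇒ q)) ∘ sym) all₁)
                                   (All.map (λ q e → proj₂ (X₂⇒ x₁ q) (here (sym e))) all₂)))
         ∷ All.++⁺ (All.map (λ q e → proj₂ (Y⇒ x₂ q) (here (sym e))) all₃)
                   (All.++⁺ (All.map (λ q → adj⇒≢ G (proj₁ (X₁⇒ q))) all₁)
                            (All.map (λ q → adj⇒≢ G (proj₁ (X₂⇒ x₁ q))) all₂))
         ∷ Unique.++⁺ u₃ (Unique.++⁺ u₁ u₂ (disjoint₁₂ x₁ all₂)) (disjoint-y x₁ x₂ all₁ all₃))
        (v~u ∷ All.map (proj₁ ∘ Y⇒ x₂) all₃)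
        (All.++⁺ (All.map (proj₁ ∘ X₁⇒) all₁) (All.map (proj₁ ∘ X₂⇒ x₁) all₂))

-- Arithmetic of the deficit

≤⇒∃ : ∀ {m n} → m ≤ n → ∃[ d ] m + d ≡ n
≤⇒∃ m≤n = _ , m+[n∸m]≡n m≤n

Periodic : ℕ → ℕ → ℕ → Set
Periodic N q d = ∃[ j ] ∃[ r ] ∃[ r′ ] q ≡ j * N + r × r + r′ ≡ N × r * r′ ≤ d

-- For N = 9 + M the exceptional size 13 + 2 * M is 2N − 5, and 4 + M is N − 5.
Loose : ℕ → ℕ → ℕ → Set
Loose M s l = s ≡ 0 ⊎ (9 + M ≤ s × 2 * s ≤ l × (s ≡ 13 + 2 * M → 5 * (4 + M) ≤ l))

-- If x + y > N then x′ + y′ ≤ N, and r (N − r) is invariant under r ↦ N − r.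
Periodic-+ : ∀ {N q d q′ d′} → Periodic N q d → Periodic N q′ d′ → Periodic N (q + q′) (d + d′)
Periodic-+ {N} {d = d} {d′ = d′} (j , x , x′ , refl , x+x′ , ≤d) (i , y , y′ , refl , y+y′ , ≤d′)
  with ≤-total (x + y) N
... | inj₁ x+y≤N = let z , e = ≤⇒∃ x+y≤N in
  j + i , x + y , z , split j i N x y , e
  , ≤-trans (bound z (+-cancelˡ-≡ x _ _ (trans x+x′ (trans (sym e) (+-assoc x y z))))
                     (+-cancelˡ-≡ y _ _ (trans y+y′ (trans (sym e) (trans (cong (_+ z) (+-comm x y)) (+-assoc y x z))))))
            (+-mono-≤ ≤d ≤d′)
  where
  split : ∀ j i N x y → (j * N + x) + (i * N + y) ≡ (j + i) * N + (x + y)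
  split = solve-∀
  -- Merging K_x and K_y into one clique adds 2xy to the degree sum.
  ring : ∀ x y z → (x + y) * z + 2 * (x * y) ≡ x * (y + z) + y * (x + z)
  ring = solve-∀
  bound : ∀ z → x′ ≡ y + z → y′ ≡ x + z → (x + y) * z ≤ x * x′ + y * y′
  bound z refl refl = ≤-by (2 * (x * y)) (ring x y z)
-- A full K_N splits off; z = x + y - N remains, and its complement is x′ + y′.
... | inj₂ N≤x+y = let z , e = ≤⇒∃ (+-cancelʳ-≤ N _ _ (x′+y′≤N N≤x+y)) in
  suc (j + i) , z , x′ + y′
  , split z e , trans (+-comm z (x′ + y′)) e
  , ≤-trans (bound z (x-eq z e) (y-eq z e)) (+-mono-≤ ≤d ≤d′)
  where
  open ≤-Reasoning
  rearrange : ∀ x′ y′ x y → (x′ + y′) + (x + y) ≡ (x + x′) + (y + y′)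
  rearrange = solve-∀
  x′+y′≤N : N ≤ x + y → (x′ + y′) + N ≤ N + N
  x′+y′≤N h = begin
    (x′ + y′) + N       ≤⟨ +-monoʳ-≤ (x′ + y′) h ⟩
    (x′ + y′) + (x + y) ≡⟨ rearrange x′ y′ x y ⟩
    (x + x′) + (y + y′) ≡⟨ cong₂ _+_ x+x′ y+y′ ⟩
    N + N               ∎
  x-eq : ∀ z → x′ + y′ + z ≡ N → x ≡ z + y′
  x-eq z e = +-cancelˡ-≡ x′ _ _ (trans (+-comm x′ x) (trans x+x′ (trans (sym e) (r x′ y′ z))))
    where
    r : ∀ a b c → a + b + c ≡ a + (c + b)
    r = solve-∀
  y-eq : ∀ z → x′ + y′ + z ≡ N → y ≡ z + x′
  y-eq z e = +-cancelˡ-≡ y′ _ _ (trans (+-comm y′ y) (trans y+y′ (trans (sym e) (r x′ y′ z))))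
    where
    r : ∀ a b c → a + b + c ≡ b + (c + a)
    r = solve-∀
  ring : ∀ x′ y′ z → z * (x′ + y′) + 2 * (x′ * y′) ≡ (z + y′) * x′ + (z + x′) * y′
  ring = solve-∀
  bound : ∀ z → x ≡ z + y′ → y ≡ z + x′ → z * (x′ + y′) ≤ x * x′ + y * y′
  bound z refl refl = ≤-by (2 * (x′ * y′)) (ring x′ y′ z)
  ring₂ : ∀ j i N x′ y′ z → (j * N + (z + y′)) + (i * N + (z + x′)) ≡ (x′ + y′ + z) + (j + i) * N + z
  ring₂ = solve-∀
  split : ∀ z → x′ + y′ + z ≡ N → (j * N + x) + (i * N + y) ≡ suc (j + i) * N + z
  split z e = trans (cong₂ (λ s t → (j * N + s) + (i * N + t)) (x-eq z e) (y-eq z e))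
                    (trans (ring₂ j i N x′ y′ z) (cong (λ t → t + (j + i) * N + z) e))

-- Two nonempty loose parts have at least 2N vertices together, so the exceptional size 2N - 5 never
-- arises as a proper sum.
Loose-+ : ∀ {M s l s′ l′} → Loose M s l → Loose M s′ l′ → Loose M (s + s′) (l + l′)
Loose-+ {l = l} {s′ = s′} {l′} (inj₁ refl) (inj₁ refl) = inj₁ refl
Loose-+ {l = l} {s′ = s′} {l′} (inj₁ refl) (inj₂ (N≤ , 2s≤ , h)) =
  inj₂ (N≤ , ≤-trans 2s≤ (m≤n+m _ l) , λ e → ≤-trans (h e) (m≤n+m _ l))
Loose-+ {M} {s} {l} {l′ = l′} (inj₂ (N≤ , 2s≤ , h)) (inj₁ refl) =
  subst (λ t → Loose M t (l + l′)) (sym (+-identityʳ s))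
    (inj₂ (N≤ , ≤-trans 2s≤ (m≤m+n _ l′) , λ e → ≤-trans (h e) (m≤m+n _ l′)))
Loose-+ {M} {s} {l} {s′} {l′} (inj₂ (N≤ , 2s≤ , _)) (inj₂ (N≤′ , 2s≤′ , _)) =
  inj₂ ( ≤-trans N≤ (m≤m+n s s′)
       , ≤-trans (≤-reflexive (*-distribˡ-+ 2 s s′)) (+-mono-≤ 2s≤ 2s≤′)
       , λ e → contradiction (subst (13 + 2 * M <_) e (≤-trans (≤-by 4 (ring M)) (+-mono-≤ N≤ N≤′))) (<-irrefl refl))
  where
  ring : ∀ M → suc (13 + 2 * M) + 4 ≡ (9 + M) + (9 + M)
  ring = solve-∀

-- If j = k, then s < N, hence s = 0 and r = N - 5: the value of the extremal graph. If j < k, a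
-- residue of at most N cannot fill the gap, so a loose part is present and its gain has to be
-- balanced against r (N - r).
deficit-bound : ∀ {M k q s d l} → Periodic (9 + M) q d → Loose M s l → q + s ≡ k * (9 + M) + (4 + M) →
                5 * (4 + M) ≤ d + l
deficit-bound {M} {k} {s = s} {d} {l} (j , r , r′ , refl , r+r′ , rr′≤) loose e with <-cmp j k
... | tri> _ _ k<j = contradiction below (<-irrefl refl)
  where
  open ≤-Reasoning
  i = proj₁ (≤⇒∃ k<j)
  ring : ∀ k N i r s → (k * N + N) + (i * N + r + s) ≡ ((1 + k) + i) * N + r + s
  ring = solve-∀
  below : suc (k * (9 + M) + (9 + M)) ≤ k * (9 + M) + (9 + M)
  below = begin
    suc (k * (9 + M) + (9 + M))                           ≤⟨ s≤s (m≤m+n _ _) ⟩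
    suc (k * (9 + M) + (9 + M) + (i * (9 + M) + r + s))   ≡⟨ cong suc (ring k (9 + M) i r s) ⟩
    suc (((1 + k) + i) * (9 + M) + r + s)                 ≡⟨ cong (λ t → suc (t * (9 + M) + r + s)) (proj₂ (≤⇒∃ k<j)) ⟩
    suc (j * (9 + M) + r + s)                             ≡⟨ cong suc e ⟩
    suc (k * (9 + M) + (4 + M))                           ≡⟨ sym (+-suc (k * (9 + M)) (4 + M)) ⟩
    k * (9 + M) + (5 + M)                                 ≤⟨ +-monoʳ-≤ (k * (9 + M)) (+-monoˡ-≤ M (m≤m+n 5 4)) ⟩
    k * (9 + M) + (9 + M)                                 ∎
... | tri≈ _ refl _ = small loose
  where
  r+s : r + s ≡ 4 + M
  r+s = +-cancelˡ-≡ (j * (9 + M)) _ _ (trans (sym (+-assoc (j * (9 + M)) r s)) e)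
  small : Loose M s l → 5 * (4 + M) ≤ d + l
  small (inj₂ (N≤s , _)) = contradiction (≤-trans N≤s (≤-trans (m≤n+m s r) (≤-reflexive r+s)))
                                         (<⇒≱ (+-monoˡ-≤ M (m≤m+n 5 4)))
  small (inj₁ refl) = ≤-trans (≤-reflexive (trans (*-comm 5 (4 + M)) (cong₂ _*_ (sym r≡) (sym r′≡))))
                              (≤-trans rr′≤ (m≤m+n d l))
    where
    r≡ : r ≡ 4 + M
    r≡ = trans (sym (+-identityʳ r)) r+s
    ring : ∀ M → 9 + M ≡ 4 + M + 5
    ring = solve-∀
    r′≡ : r′ ≡ 5
    r′≡ = +-cancelˡ-≡ (4 + M) _ _ (trans (cong (_+ r′) (sym r≡)) (trans r+r′ (ring M)))
... | tri< j<k _ _ = large loose (proj₁ (≤⇒∃ j<k)) r r′ r+r′ rr′≤ r+s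
  where
  open ≤-Reasoning
  r+s : r + s ≡ suc (proj₁ (≤⇒∃ j<k)) * (9 + M) + (4 + M)
  r+s = +-cancelˡ-≡ (j * (9 + M)) _ _
          (trans (sym (+-assoc (j * (9 + M)) r s))
            (trans e (trans (cong (λ t → t * (9 + M) + (4 + M)) (sym (proj₂ (≤⇒∃ j<k))))
                            (ring j (proj₁ (≤⇒∃ j<k)) (9 + M) (4 + M)))))
    where
    ring : ∀ j i N q → (suc j + i) * N + q ≡ j * N + (suc i * N + q)
    ring = solve-∀
  large : Loose M s l → ∀ i r r′ → r + r′ ≡ 9 + M → r * r′ ≤ d → r + s ≡ suc i * (9 + M) + (4 + M) → 5 * (4 + M) ≤ d + l
  large (inj₁ refl) i r r′ r+r′ rr′≤ e = contradiction (begin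
      suc (9 + M)                   ≤⟨ ≤-by (i * (9 + M) + (3 + M)) (ring i M) ⟩
      suc i * (9 + M) + (4 + M)     ≡⟨ sym e ⟩
      r + 0                         ≡⟨ +-identityʳ r ⟩
      r                             ≤⟨ m≤m+n r r′ ⟩
      r + r′                        ≡⟨ r+r′ ⟩
      9 + M                         ∎) (<-irrefl refl)
    where
    ring : ∀ i M → suc (9 + M) + (i * (9 + M) + (3 + M)) ≡ suc i * (9 + M) + (4 + M)
    ring = solve-∀
  large (inj₂ (N≤s , 2s≤l , special)) zero zero r′ r+r′ rr′≤ e = ≤-trans (special (trans e (ring M))) (m≤n+m l d)
    where
    ring : ∀ M → 1 * (9 + M) + (4 + M) ≡ 13 + 2 * M
    ring = solve-∀
  -- With r = t + 1 and s = N + w the total gives N = t + w + 6, so that r′ = w + 5 and the claim is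
  -- polynomial in t and w.
  large (inj₂ (N≤s , 2s≤l , special)) zero (suc t) r′ r+r′ rr′≤ e = begin
    5 * (4 + M)                                  ≡⟨ ring₅ M ⟩
    5 * (1 + (3 + M))                            ≡⟨ cong (λ m → 5 * (1 + m)) t+w ⟩
    5 * (1 + (t + w))                            ≤⟨ ≤-by (12 + 2 * t + t * w) (ring₆ t w) ⟩
    suc t * (5 + w) + 2 * (6 + (t + w) + w)      ≡⟨ cong₂ (λ a b → suc t * a + 2 * b) (sym r′≡) s≡ ⟩
    suc t * r′ + 2 * s                           ≤⟨ +-mono-≤ rr′≤ 2s≤l ⟩
    d + l                                        ∎
    where
    w = proj₁ (≤⇒∃ N≤s)
    ring₁ : ∀ M → 1 * (9 + M) + (4 + M) ≡ 10 + M + (3 + M)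
    ring₁ = solve-∀
    ring₂ : ∀ M t w → 10 + M + (t + w) ≡ suc t + (9 + M + w)
    ring₂ = solve-∀
    t+w : 3 + M ≡ t + w
    t+w = +-cancelˡ-≡ (10 + M) _ _ (trans (sym (ring₁ M))
            (trans (sym e) (trans (cong (suc t +_) (sym (proj₂ (≤⇒∃ N≤s)))) (sym (ring₂ M t w)))))
    ring₃ : ∀ t w → 6 + (t + w) ≡ suc t + (5 + w)
    ring₃ = solve-∀
    r′≡ : r′ ≡ 5 + w
    r′≡ = +-cancelˡ-≡ (suc t) _ _ (trans r+r′ (trans (cong (6 +_) t+w) (ring₃ t w)))
    s≡ : 6 + (t + w) + w ≡ s
    s≡ = trans (cong (λ m → 6 + m + w) (sym t+w)) (proj₂ (≤⇒∃ N≤s))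
    ring₅ : ∀ M → 5 * (4 + M) ≡ 5 * (1 + (3 + M))
    ring₅ = solve-∀
    ring₆ : ∀ t w → 5 * (1 + (t + w)) + (12 + 2 * t + t * w) ≡ suc t * (5 + w) + 2 * (6 + (t + w) + w)
    ring₆ = solve-∀
  -- Here r = N contributes nothing, just as r = 0 does, and again s = 2N - 5.
  large (inj₂ (N≤s , 2s≤l , special)) (suc zero) r zero r+r′ rr′≤ e = ≤-trans (special s≡) (m≤n+m l d)
    where
    ring : ∀ M → 2 * (9 + M) + (4 + M) ≡ 9 + M + (13 + 2 * M)
    ring = solve-∀
    s≡ : s ≡ 13 + 2 * M
    s≡ = +-cancelˡ-≡ r _ _ (trans e (trans (ring M) (cong (_+ (13 + 2 * M)) (trans (sym r+r′) (+-identityʳ r)))))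
  large (inj₂ (N≤s , 2s≤l , special)) (suc zero) r (suc t) r+r′ rr′≤ e = begin
    5 * (4 + M)                                ≤⟨ ≤-by (16 + r * t + t) (ring₁ M r t) ⟩
    r * t + t + (28 + 4 * M) + (8 + M)         ≡⟨ cong (r * t + t + (28 + 4 * M) +_) (sym r+t) ⟩
    r * t + t + (28 + 4 * M) + (r + t)         ≡⟨ ring₂ M r t ⟩
    r * suc t + 2 * (14 + 2 * M + t)           ≡⟨ cong (λ m → r * suc t + 2 * m) (sym s≡) ⟩
    r * suc t + 2 * s                          ≤⟨ +-mono-≤ rr′≤ 2s≤l ⟩
    d + l                                      ∎
    where
    ring₁ : ∀ M r t → 5 * (4 + M) + (16 + r * t + t) ≡ r * t + t + (28 + 4 * M) + (8 + M)
    ring₁ = solve-∀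
    ring₂ : ∀ M r t → r * t + t + (28 + 4 * M) + (r + t) ≡ r * suc t + 2 * (14 + 2 * M + t)
    ring₂ = solve-∀
    r+t : r + t ≡ 8 + M
    r+t = suc-injective (trans (sym (+-suc r t)) r+r′)
    ring₃ : ∀ M t → 2 * (9 + M) + (4 + M) + t ≡ 8 + M + (14 + 2 * M + t)
    ring₃ = solve-∀
    swap : ∀ r s t → r + t + s ≡ r + s + t
    swap = solve-∀
    s≡ : s ≡ 14 + 2 * M + t
    s≡ = +-cancelˡ-≡ (8 + M) _ _ (trans (cong (_+ s) (sym r+t))
           (trans (swap r s t) (trans (cong (_+ t) e) (ring₃ M t))))
  -- Now s ≥ 3N - 5, and 2s suffices alone.
  large (inj₂ (N≤s , 2s≤l , special)) (suc (suc i)) r r′ r+r′ rr′≤ e = begin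
    5 * (4 + M)          ≤⟨ ≤-by (24 + M) (ring₁ M) ⟩
    2 * (22 + 3 * M)     ≤⟨ *-monoʳ-≤ 2 22≤s ⟩
    2 * s                ≤⟨ 2s≤l ⟩
    l                    ≤⟨ m≤n+m l d ⟩
    d + l                ∎
    where
    ring₁ : ∀ M → 5 * (4 + M) + (24 + M) ≡ 2 * (22 + 3 * M)
    ring₁ = solve-∀
    ring₂ : ∀ i M → 9 + M + (22 + 3 * M) + i * (9 + M) ≡ suc (suc (suc i)) * (9 + M) + (4 + M)
    ring₂ = solve-∀
    22≤s : 22 + 3 * M ≤ s
    22≤s = +-cancelˡ-≤ (9 + M) _ _ (begin
      9 + M + (22 + 3 * M)                     ≤⟨ ≤-by (i * (9 + M)) (ring₂ i M) ⟩
      suc (suc (suc i)) * (9 + M) + (4 + M)    ≡⟨ sym e ⟩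
      r + s                                    ≤⟨ +-monoˡ-≤ s (m≤m+n r r′) ⟩
      r + r′ + s                               ≡⟨ cong (_+ s) r+r′ ⟩
      9 + M + s                                ∎)

-- Peeling off vertex sets

infix 4 _⊆_

_⊆_ : ∀ {p} → Subset p → Subset p → Set
A ⊆ B = ∀ x → A x ≡ true → B x ≡ true

module _ {p : ℕ} where

  count-∩ʳ : ∀ {S A : Subset p} → A ⊆ S → count S ≡ count A + count (S ∩ ∁ A)
  count-∩ʳ {S} {A} A⊆S = trans (count-split S A) (cong (_+ count (S ∩ ∁ A)) (count-cong pt))
    where
    pt : ∀ x → (S ∩ A) x ≡ A x
    pt x with A x in eq
    ... | true  rewrite A⊆S x eq = refl
    ... | false with S x
    ...   | true  = refl
    ...   | false = refl

module Peeling {p : ℕ} (a : Fin p → Fin p → Bool) (a-sym : ∀ x y → a x y ≡ a y x) (a-irr : ∀ x → a x x ≡ false) where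

  arcs : Subset p → Subset p → ℕ
  arcs P Q = sumOn P (deg a Q)

  arcs-∑ : ∀ P Q → arcs P Q ≡ sum (λ x → sum (λ y → ⟦ P x ∧ (Q y ∧ a x y) ⟧))
  arcs-∑ P Q = sum-cong-≗ λ x →
    trans (*-distribˡ-sum ⟦ P x ⟧ (λ y → ⟦ Q y ∧ a x y ⟧)) (sum-cong-≗ (λ y → ⟦⟧-∧ (P x) (Q y ∧ a x y)))
    where
    ⟦⟧-∧ : ∀ b c → ⟦ b ⟧ * ⟦ c ⟧ ≡ ⟦ b ∧ c ⟧
    ⟦⟧-∧ true  c = +-identityʳ ⟦ c ⟧
    ⟦⟧-∧ false c = refl

  arcs-comm : ∀ P Q → arcs P Q ≡ arcs Q P
  arcs-comm P Q = begin
    arcs P Q                                       ≡⟨ arcs-∑ P Q ⟩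
    sum (λ x → sum (λ y → ⟦ P x ∧ (Q y ∧ a x y) ⟧)) ≡⟨ ∑-comm (λ x y → ⟦ P x ∧ (Q y ∧ a x y) ⟧) ⟩
    sum (λ y → sum (λ x → ⟦ P x ∧ (Q y ∧ a x y) ⟧)) ≡⟨ sum-cong-≗ (λ y → sum-cong-≗ (λ x → pt x y)) ⟩
    sum (λ y → sum (λ x → ⟦ Q y ∧ (P x ∧ a y x) ⟧)) ≡⟨ sym (arcs-∑ Q P) ⟩
    arcs Q P                                       ∎
    where
    open ≡-Reasoning
    pt : ∀ x y → ⟦ P x ∧ (Q y ∧ a x y) ⟧ ≡ ⟦ Q y ∧ (P x ∧ a y x) ⟧
    pt x y rewrite a-sym x y with P x | Q y
    ... | true  | _     = refl
    ... | false | true  = refl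
    ... | false | false = refl

  -- Bounding the arcs pointwise reduces each way of peeling to a finite check on Booleans.
  arcs-cover : ∀ S B P Q R T →
    (∀ x y → a x y ≡ true → ⟦ S x ∧ S y ⟧ ≤ ⟦ B x ∧ B y ⟧ + ⟦ P x ∧ Q y ⟧ + ⟦ R x ∧ T y ⟧) →
    arcs S S ≤ arcs B B + arcs P Q + arcs R T
  arcs-cover S B P Q R T h = begin
    arcs S S                                                    ≡⟨ arcs-∑ S S ⟩
    sum (λ x → sum (λ y → f S S x y))                           ≤⟨ sum-mono (λ x → sum-mono (λ y → pt x y)) ⟩
    sum (λ x → sum (λ y → f B B x y + f P Q x y + f R T x y))   ≡⟨ sum-cong-≗ (λ x → trans
         (∑-distrib-+ (λ y → f B B x y + f P Q x y) (f R T x))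
         (cong (_+ sum (f R T x)) (∑-distrib-+ (f B B x) (f P Q x)))) ⟩
    sum (λ x → sum (f B B x) + sum (f P Q x) + sum (f R T x))   ≡⟨ trans
         (∑-distrib-+ (λ x → sum (f B B x) + sum (f P Q x)) (λ x → sum (f R T x)))
         (cong (_+ sum (λ x → sum (f R T x))) (∑-distrib-+ (λ x → sum (f B B x)) (λ x → sum (f P Q x)))) ⟩
    _                                                           ≡⟨ sym (cong₂ _+_ (cong₂ _+_ (arcs-∑ B B) (arcs-∑ P Q)) (arcs-∑ R T)) ⟩
    arcs B B + arcs P Q + arcs R T                              ∎
    where
    open ≤-Reasoning
    f : Subset p → Subset p → Fin p → Fin p → ℕ
    f P Q x y = ⟦ P x ∧ (Q y ∧ a x y) ⟧
    assoc-∧ : ∀ b c d → d ≡ true → b ∧ (c ∧ d) ≡ b ∧ c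
    assoc-∧ b true  d refl = refl
    assoc-∧ b false d refl = refl
    zero-∧ : ∀ b c d → d ≡ false → b ∧ (c ∧ d) ≡ false
    zero-∧ true  true  d refl = refl
    zero-∧ true  false d refl = refl
    zero-∧ false _     d refl = refl
    pt : ∀ x y → f S S x y ≤ f B B x y + f P Q x y + f R T x y
    pt x y = go (a x y) refl
      where
      go : ∀ d → a x y ≡ d → f S S x y ≤ f B B x y + f P Q x y + f R T x y
      go true  e rewrite assoc-∧ (S x) (S y) _ e | assoc-∧ (B x) (B y) _ e | assoc-∧ (P x) (Q y) _ e
                       | assoc-∧ (R x) (T y) _ e = h x y e
      go false e rewrite zero-∧ (S x) (S y) _ e = z≤n

  -- An arc lost with A starts in A or enters A from the rest; by symmetry the latter are the arcs
  -- from A to the rest. Each vertex of A is thus charged its degree plus its number of outside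
  -- neighbours, to be compared with N - 1.
  arcs-peel : ∀ S A → A ⊆ S →
    arcs S S ≤ arcs (S ∩ ∁ A) (S ∩ ∁ A) + sumOn A (λ x → deg a S x + deg a (S ∩ ∁ A) x)
  arcs-peel S A A⊆S = begin
    arcs S S                               ≤⟨ arcs-cover S B A S B A (λ x y _ → pt x y) ⟩
    arcs B B + arcs A S + arcs B A         ≡⟨ cong (arcs B B + arcs A S +_) (arcs-comm B A) ⟩
    arcs B B + arcs A S + arcs A B         ≡⟨ +-assoc (arcs B B) (arcs A S) (arcs A B) ⟩
    arcs B B + (arcs A S + arcs A B)       ≡⟨ cong (arcs B B +_) (sym (sumOn-+ A (deg a S) (deg a B))) ⟩
    arcs B B + sumOn A (λ x → deg a S x + deg a B x) ∎
    where
    open ≤-Reasoning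
    B = S ∩ ∁ A
    pt : ∀ x y → ⟦ S x ∧ S y ⟧ ≤ ⟦ B x ∧ B y ⟧ + ⟦ A x ∧ S y ⟧ + ⟦ B x ∧ A y ⟧
    pt x y with S x | S y | A x | A y in eq
    ... | false | _     | _     | _     = z≤n
    ... | true  | false | _     | _     = z≤n
    ... | true  | true  | true  | _     = s≤s z≤n
    ... | true  | true  | false | true  = s≤s z≤n
    ... | true  | true  | false | false = s≤s z≤n

  closed : Subset p → Fin p → Subset p
  closed S v = S ∩ closedNbhd a v

  count-closed : ∀ S v → S v ≡ true → count (closed S v) ≡ suc (deg a S v)
  count-closed S v v∈S = begin
    count (closed S v)                                       ≡⟨ sum-cong-≗ pt ⟩
    sum (λ y → ⟦ does (y ≟ᶠ v) ⟧ + ⟦ S y ∧ a v y ⟧)          ≡⟨ ∑-distrib-+ (λ y → ⟦ does (y ≟ᶠ v) ⟧) (λ y → ⟦ S y ∧ a v y ⟧) ⟩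
    count (λ y → does (y ≟ᶠ v)) + deg a S v                  ≡⟨ cong (_+ deg a S v) (count-singleton v) ⟩
    suc (deg a S v)                                          ∎
    where
    open ≡-Reasoning
    pt : ∀ y → ⟦ S y ∧ (does (y ≟ᶠ v) ∨ a v y) ⟧ ≡ ⟦ does (y ≟ᶠ v) ⟧ + ⟦ S y ∧ a v y ⟧
    pt y with y ≟ᶠ v
    ... | no  _    = refl
    ... | yes refl rewrite v∈S | a-irr v = refl

  v∈closed : ∀ S v → S v ≡ true → closed S v v ≡ true
  v∈closed S v v∈S rewrite v∈S | dec-true (v ≟ᶠ v) refl = refl

  closed⁻ : ∀ S v x → closed S v x ≡ true → S x ≡ true × (x ≡ v ⊎ a v x ≡ true)
  closed⁻ S v x e with ∧⁻ {S x} e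
  ... | Sx , e′ with x ≟ᶠ v
  ...   | yes x≡v = Sx , inj₁ x≡v
  ...   | no  _   = Sx , inj₂ e′

  -- u is adjacent to v, so the vertices counted by out miss at least v itself.
  out<deg : ∀ S v u → S v ≡ true → a v u ≡ true → out a S v u < deg a S u
  out<deg S v u v∈S v~u = ≤-trans
    (+-monoˡ-≤ (out a S v u) (∃⇒count (nbhd a S u ∩ closedNbhd a v) v (∧⁺ (∧⁺ v∈S (trans (a-sym u v) v~u)) refl′)))
    (≤-reflexive (sym (count-split (nbhd a S u) (closedNbhd a v))))
    where
    refl′ : closedNbhd a v v ≡ true
    refl′ rewrite dec-true (v ≟ᶠ v) refl = refl

  deg-rest≤out : ∀ S A v x → closed S v ⊆ A → deg a (S ∩ ∁ A) x ≤ out a S v x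
  deg-rest≤out S A v x sub = count-mono pt
    where
    pt : ∀ y → nbhd a (S ∩ ∁ A) x y ≡ true → (nbhd a S x ∩ ∁ closedNbhd a v) y ≡ true
    pt y e with ∧⁻ {(S ∩ ∁ A) y} e
    ... | e₁ , x~y with ∧⁻ {S y} e₁
    ...   | Sy , ¬Ay = ∧⁺ (∧⁺ Sy x~y) (not-true (closedNbhd a v y) refl)
      where
      not-true : ∀ b → closedNbhd a v y ≡ b → not b ≡ true
      not-true false _  = refl
      not-true true  c  = contradiction (trans (sym ¬Ay) (cong not (sub y (∧⁺ Sy c)))) λ ()

  deg-rest-centre : ∀ S A v → closed S v ⊆ A → deg a (S ∩ ∁ A) v ≡ 0
  deg-rest-centre S A v sub = count-empty (nbhd a (S ∩ ∁ A) v) (λ y → ¬-not (pt y))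
    where
    pt : ∀ y → ¬ nbhd a (S ∩ ∁ A) v y ≡ true
    pt y e with ∧⁻ {(S ∩ ∁ A) y} e
    ... | e₁ , v~y with ∧⁻ {S y} e₁
    ...   | Sy , ¬Ay = contradiction (trans (sym ¬Ay) (cong not (sub y (∧⁺ Sy v∼)))) λ ()
      where
      v∼ : closedNbhd a v y ≡ true
      v∼ with does (y ≟ᶠ v)
      ... | true  = refl
      ... | false = v~y

  deg≤ : ∀ S v → S v ≡ true → suc (deg a S v) ≤ count S
  deg≤ S v v∈S = subst (_≤ count S) (count-closed S v v∈S) (count-mono (λ y e → proj₁ (∧⁻ {S y} e)))

-- The deficit of a T³-free graph

module Upper (M : ℕ) {p : ℕ} (a : Fin p → Fin p → Bool) (a-sym : ∀ x y → a x y ≡ a y x)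
  (a-irr : ∀ x → a x x ≡ false)
  (no-T³ : ∀ S v u k → k ≤ 3 → a v u ≡ true → 4 ≤ deg a S u → 9 + M ≤ deg a S v + k → ¬ k ≤ out a S v u)
  where

  open Peeling a a-sym a-irr

  -- The vertices are accounted for as q clique-like ones with deficit `d` and s loose ones with
  -- deficit `l`. Only the sizes are kept, since pieces are combined by arithmetic alone.
  Claim : Subset p → Set
  Claim S = ∃[ q ] ∃[ s ] ∃[ d ] ∃[ l ] count S ≡ q + s × Periodic (9 + M) q d × Loose M s l
            × arcs S S + (d + l) ≤ count S * (8 + M)

  extend : ∀ S A K {q s d l} → A ⊆ S → arcs S S ≤ arcs (S ∩ ∁ A) (S ∩ ∁ A) + K →
           count A ≡ q + s → Periodic (9 + M) q d → Loose M s l → K + (d + l) ≤ count A * (8 + M) →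
           Claim (S ∩ ∁ A) → Claim S
  extend S A K {q} {s} {d} {l} A⊆S arcs≤ |A| Pq Ls K≤ (q′ , s′ , d′ , l′ , |B| , Pq′ , Ls′ , B≤) =
    q + q′ , s + s′ , d + d′ , l + l′
    , trans (count-∩ʳ A⊆S) (trans (cong₂ _+_ |A| |B|) (ring₁ q s q′ s′))
    , Periodic-+ Pq Pq′ , Loose-+ Ls Ls′
    , (begin
        arcs S S + (d + d′ + (l + l′))                ≤⟨ +-monoˡ-≤ _ arcs≤ ⟩
        b + K + (d + d′ + (l + l′))                   ≡⟨ ring₂ b K d d′ l l′ ⟩
        (K + (d + l)) + (b + (d′ + l′))               ≤⟨ +-mono-≤ K≤ B≤ ⟩
        count A * (8 + M) + count (S ∩ ∁ A) * (8 + M) ≡⟨ sym (*-distribʳ-+ (8 + M) (count A) _) ⟩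
        (count A + count (S ∩ ∁ A)) * (8 + M)         ≡⟨ cong (_* (8 + M)) (sym (count-∩ʳ A⊆S)) ⟩
        count S * (8 + M)                             ∎)
    where
    open ≤-Reasoning
    b = arcs (S ∩ ∁ A) (S ∩ ∁ A)
    ring₁ : ∀ q s q′ s′ → (q + s) + (q′ + s′) ≡ (q + q′) + (s + s′)
    ring₁ = solve-∀
    ring₂ : ∀ b K d d′ l l′ → b + K + (d + d′ + (l + l′)) ≡ (K + (d + l)) + (b + (d′ + l′))
    ring₂ = solve-∀

  extend-periodic : ∀ S A {d} c → A ⊆ S → Periodic (9 + M) (count A) d →
    (∀ x → A x ≡ true → deg a S x + deg a (S ∩ ∁ A) x ≤ c) → count A * c + d ≤ count A * (8 + M) →
    Claim (S ∩ ∁ A) → Claim S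
  extend-periodic S A {d} c A⊆S P h ≤d = extend S A _ A⊆S (arcs-peel S A A⊆S) (sym (+-identityʳ _)) P (inj₁ refl)
    (≤-trans (+-mono-≤ (sumOn-≤ A c h) (≤-reflexive (+-identityʳ d))) ≤d)

  Periodic-0 : Periodic (9 + M) 0 0
  Periodic-0 = 0 , 0 , 9 + M , refl , refl , z≤n

  -- A vertex of degree at most 3 cannot play v₁, but one of its neighbours is `v`, so at most two
  -- lie outside the ball.
  few-outside : ∀ S v u k → k ≤ 3 → S v ≡ true → a v u ≡ true → 9 + M ≤ deg a S v + k →
                (deg a S u ≤ 3 × out a S v u ≤ 2) ⊎ out a S v u < k
  few-outside S v u k k≤3 v∈S v~u ≤deg with deg a S u ≤? 3
  ... | yes d≤3 = inj₁ (d≤3 , ≤-pred (≤-trans (out<deg S v u v∈S v~u) d≤3))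
  ... | no  d≰3 = inj₂ (≰⇒> (no-T³ S v u k k≤3 v~u (≰⇒> d≰3) ≤deg))

  -- Pieces to peel off, by decreasing maximal degree

  module _ (S : Subset p) where

    -- The centre has no neighbour outside A, a neighbour of small degree is charged at most 3 + 2 =
    -- 5, and any other at most k beyond its degree.
    near-centre : ∀ A v c k → suc k ≤ 3 → 5 ≤ c + k → S v ≡ true → 9 + M ≤ deg a S v + suc k →
                  closed S v ⊆ A → (∀ x → S x ≡ true → deg a S x ≤ c) →
                  ∀ x → closed S v x ≡ true → deg a S x + deg a (S ∩ ∁ A) x ≤ c + k
    near-centre A v c k k<3 5≤ v∈S ≤deg sub Δ≤ x x∈ with closed⁻ S v x x∈
    ... | Sx , inj₁ refl = +-mono-≤ (Δ≤ x Sx) (≤-trans (≤-reflexive (deg-rest-centre S A v sub)) z≤n)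
    ... | Sx , inj₂ v~x with few-outside S v x (suc k) k<3 v∈S v~x ≤deg
    ...   | inj₁ (d≤ , o≤) = ≤-trans (+-mono-≤ d≤ (≤-trans (deg-rest≤out S A v x sub) o≤)) 5≤
    ...   | inj₂ o<        = +-mono-≤ (Δ≤ x Sx) (≤-trans (deg-rest≤out S A v x sub) (≤-pred o<))

    -- With k = 0 in `few-outside`, every neighbour of a vertex in `H` has degree at most 3. So all
    -- arcs that meet A have an end in `L`, and there are at most 2 · 3 · |L| of them.
    star : ∀ v → S v ≡ true → 9 + M ≤ deg a S v →
           ∃[ A ] A v ≡ true × (Claim (S ∩ ∁ A) → Claim S)
    star v v∈S ≤deg = A , ∨⁺ˡ (v∈H v v∈S ≤deg) , extend S A (arcs L S + arcs S L) A⊆S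
        (subst (arcs S S ≤_) (+-assoc (arcs B B) _ _) (arcs-cover S B L S S L cover))
        -- The gain per vertex is (N - 1) - 6 = N - 7 = 2 + M. This covers both 2s and the
        -- exceptional size.
        refl Periodic-0 (inj₂ (N≤A , 2A≤ , λ e → subst (λ c → 5 * (4 + M) ≤ c * (2 + M)) (sym e) (≤-by _ (ring₁ M))))
        (begin
          arcs L S + arcs S L + count A * (2 + M) ≤⟨ +-monoˡ-≤ _ (+-mono-≤ arcs≤ (≤-trans (≤-reflexive (arcs-comm S L)) arcs≤)) ⟩
          count A * 3 + count A * 3 + count A * (2 + M) ≡⟨ ring₂ (count A) M ⟩
          count A * (8 + M)                       ∎)
      where
      open ≤-Reasoning
      ∨⁺ˡ : ∀ {b c} → b ≡ true → b ∨ c ≡ true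
      ∨⁺ˡ refl = refl
      ∨⁺ʳ : ∀ {b c} → c ≡ true → b ∨ c ≡ true
      ∨⁺ʳ {true}  _    = refl
      ∨⁺ʳ {false} refl = refl
      H L A B : Subset p
      H x = S x ∧ does (9 + M ≤? deg a S x)
      near? : ∀ x → Dec (∃[ h ] H h ≡ true × a h x ≡ true)
      near? x = any? (λ h → (H h ≟ᵇ true) ×-dec (a h x ≟ᵇ true))
      L x = S x ∧ does (near? x)
      A = H ∪ L
      B = S ∩ ∁ A
      v∈H : ∀ v → S v ≡ true → 9 + M ≤ deg a S v → H v ≡ true
      v∈H v v∈S ≤deg = ∧⁺ v∈S (dec-true (9 + M ≤? deg a S v) ≤deg)
      H-adj-L : ∀ h x → H h ≡ true → S x ≡ true → a h x ≡ true → L x ≡ true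
      H-adj-L h x Hh Sx h~x = ∧⁺ Sx (dec-true (near? x) (h , Hh , h~x))
      A⊆S : A ⊆ S
      A⊆S x e with S x
      ... | true = refl
      L-deg : ∀ x → L x ≡ true → deg a S x ≤ 3
      L-deg x Lx with does⁻ (near? x) (proj₂ (∧⁻ {S x} Lx))
      ... | h , Hh , h~x with ∧⁻ {S h} Hh
      ...   | Sh , N≤ with few-outside S h x 0 z≤n Sh h~x
                             (≤-trans (does⁻ (9 + M ≤? deg a S h) N≤) (m≤m+n _ 0))
      ...     | inj₁ (d≤ , _) = d≤
      arcs≤ : arcs L S ≤ count A * 3
      arcs≤ = ≤-trans (sumOn-≤ L 3 L-deg) (*-monoˡ-≤ 3 (count-mono {A = L} {A} (λ x → ∨⁺ʳ {H x})))
      N≤A : 9 + M ≤ count A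
      N≤A = ≤-trans ≤deg (count-mono {A = nbhd a S v} {A}
              (λ x e → ∨⁺ʳ {H x} (H-adj-L v x (v∈H v v∈S ≤deg) (proj₁ (∧⁻ {S x} e)) (proj₂ (∧⁻ {S x} e)))))
      2A≤ : 2 * count A ≤ count A * (2 + M)
      2A≤ = ≤-trans (≤-reflexive (*-comm 2 (count A))) (*-monoʳ-≤ (count A) (m≤m+n 2 M))
      ring₁ : ∀ M → 5 * (4 + M) + (6 + 12 * M + 2 * M * M) ≡ (13 + 2 * M) * (2 + M)
      ring₁ = solve-∀
      ring₂ : ∀ c M → c * 3 + c * 3 + c * (2 + M) ≡ c * (8 + M)
      ring₂ = solve-∀
      cover : ∀ x y → a x y ≡ true → ⟦ S x ∧ S y ⟧ ≤ ⟦ B x ∧ B y ⟧ + ⟦ L x ∧ S y ⟧ + ⟦ S x ∧ L y ⟧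
      cover x y x~y = go (H-adj-L x y) (H-adj-L y x)
        where
        go : (H x ≡ true → S y ≡ true → a x y ≡ true → L y ≡ true) →
             (H y ≡ true → S x ≡ true → a y x ≡ true → L x ≡ true) →
             ⟦ S x ∧ S y ⟧ ≤ ⟦ (S x ∧ not (H x ∨ L x)) ∧ (S y ∧ not (H y ∨ L y)) ⟧ + ⟦ L x ∧ S y ⟧ + ⟦ S x ∧ L y ⟧
        go f g with S x | S y | H x | H y | L x | L y
        ... | false | _     | _     | _     | _     | _     = z≤n
        ... | true  | false | _     | _     | _     | _     = z≤n
        ... | true  | true  | true  | _     | true  | _     = s≤s z≤n
        ... | true  | true  | false | _     | true  | _     = s≤s z≤n
        ... | true  | true  | _     | _     | false | true  = m≤n+m 1 _
        ... | true  | true  | false | false | false | false = s≤s z≤n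
        ... | true  | true  | true  | _     | false | false = contradiction (f refl refl x~y) λ ()
        ... | true  | true  | false | true  | false | false = contradiction (g refl refl (trans (a-sym y x) x~y)) λ ()

    -- The ball has N vertices, each charged at most N - 1, like a component K_N.
    ball : ∀ v → S v ≡ true → deg a S v ≡ 8 + M → (∀ x → S x ≡ true → deg a S x ≤ 8 + M) →
           ∃[ A ] A v ≡ true × (Claim (S ∩ ∁ A) → Claim S)
    ball v v∈S deg≡ Δ≤ = A , v∈closed S v v∈S
      , extend-periodic S A (8 + M) (λ x e → proj₁ (∧⁻ {S x} e))
          (1 , 0 , 9 + M , trans |A| (ring M) , refl , z≤n)
          (λ x x∈ → ≤-trans (near-centre A v (8 + M) 0 (s≤s z≤n) (m≤m+n 5 _) v∈S
                               (≤-reflexive (trans (cong suc (sym deg≡)) (+-comm 1 _))) (λ _ e → e) Δ≤ x x∈)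
                            (≤-reflexive (+-identityʳ _)))
          (≤-reflexive (+-identityʳ _))
      where
      A = closed S v
      |A| : count A ≡ 9 + M
      |A| = trans (count-closed S v v∈S) (cong suc deg≡)
      ring : ∀ M → 9 + M ≡ 1 * (9 + M) + 0
      ring = solve-∀

    -- The charge of `x` exceeds what K_{N-1} allows only if `x` has degree N - 2 and exactly one
    -- neighbour outside the ball of `v`. Then `x` is a centre as well, and the union of both balls
    -- has N vertices, for which the weaker charge N - 1 is affordable.
    double-ball : ∀ v x → S v ≡ true → deg a S v ≡ 7 + M → (∀ x → S x ≡ true → deg a S x ≤ 7 + M) →
      closed S v x ≡ true → 8 + M ≤ deg a S x + deg a (S ∩ ∁ closed S v) x →
      ∃[ A ] A v ≡ true × (Claim (S ∩ ∁ A) → Claim S)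
    double-ball v x v∈S deg≡ Δ≤ x∈ bad = result (closed⁻ S v x x∈)
      where
      open ≤-Reasoning
      C = closed S v
      rest = deg a (S ∩ ∁ C) x
      v-centre : 9 + M ≤ deg a S v + 2
      v-centre = ≤-reflexive (trans (cong (2 +_) (sym deg≡)) (+-comm 2 _))
      near : ∀ A u → closed S u ⊆ A → S u ≡ true → 9 + M ≤ deg a S u + 2 →
             ∀ y → closed S u y ≡ true → deg a S y + deg a (S ∩ ∁ A) y ≤ 8 + M
      near A u sub u∈S u-centre y y∈ = ≤-trans
        (near-centre A u (7 + M) 1 (s≤s (s≤s z≤n)) (≤-trans (m≤m+n 5 (2 + M)) (m≤m+n (7 + M) 1)) u∈S u-centre sub Δ≤ y y∈)
        (≤-reflexive (+-comm _ 1))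
      result : S x ≡ true × (x ≡ v ⊎ a v x ≡ true) → ∃[ A ] A v ≡ true × (Claim (S ∩ ∁ A) → Claim S)
      result (_ , inj₁ refl) = contradiction (begin
        8 + M            ≤⟨ bad ⟩
        deg a S x + rest ≡⟨ cong₂ _+_ deg≡ (deg-rest-centre S C v (λ _ e → e)) ⟩
        7 + M + 0        ≡⟨ +-identityʳ _ ⟩
        7 + M            ∎) (<-irrefl refl)
      result (Sx , inj₂ v~x) = A , ∧⁺ v∈S (C⊆A′ v (v∈closed S v v∈S))
        , extend-periodic S A (8 + M) (λ y e → proj₁ (∧⁻ {S y} e))
            (1 , 0 , 9 + M , trans |A| (ring M) , refl , z≤n) bound (≤-reflexive (+-identityʳ _))
        where
        D A : Subset p
        D y = closedNbhd a v y ∨ closedNbhd a x y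
        A = S ∩ D
        ring : ∀ M → 9 + M ≡ 1 * (9 + M) + 0
        ring = solve-∀
        C⊆A′ : ∀ y → C y ≡ true → D y ≡ true
        C⊆A′ y e rewrite proj₂ (∧⁻ {S y} e) = refl
        C⊆A : C ⊆ A
        C⊆A y e = ∧⁺ (proj₁ (∧⁻ {S y} e)) (C⊆A′ y e)
        X⊆A : closed S x ⊆ A
        X⊆A y e = ∧⁺ (proj₁ (∧⁻ {S y} e)) (go (closedNbhd a v y) (proj₂ (∧⁻ {S y} e)))
          where
          go : ∀ b {c} → c ≡ true → b ∨ c ≡ true
          go true  _ = refl
          go false e = e
        rest≤1 : rest ≤ 1
        rest≤1 with few-outside S v x 2 (s≤s (s≤s z≤n)) v∈S v~x v-centre
        ... | inj₂ o<        = ≤-trans (deg-rest≤out S C v x (λ _ e → e)) (≤-pred o<)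
        ... | inj₁ (d≤ , o≤) = contradiction
                (≤-trans bad (+-mono-≤ d≤ (≤-trans (deg-rest≤out S C v x (λ _ e → e)) o≤)))
                (<⇒≱ (m≤m+n 6 _))
        rest≡1 : rest ≡ 1
        rest≡1 = ≤-antisym rest≤1 (+-cancelˡ-≤ (7 + M) _ _ (begin
          7 + M + 1        ≡⟨ +-comm (7 + M) 1 ⟩
          8 + M            ≤⟨ bad ⟩
          deg a S x + rest ≤⟨ +-monoˡ-≤ rest (Δ≤ x Sx) ⟩
          7 + M + rest     ∎))
        x-centre : 9 + M ≤ deg a S x + 2
        x-centre = begin
          9 + M                ≤⟨ s≤s bad ⟩
          suc (deg a S x + rest) ≡⟨ sym (+-suc _ rest) ⟩
          deg a S x + suc rest ≡⟨ cong (λ r → deg a S x + suc r) rest≡1 ⟩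
          deg a S x + 2        ∎
        -- As `x` lies in C, the second ball adds to C just the outside neighbours of `x`.
        new : ∀ y → (A ∩ ∁ C) y ≡ nbhd a (S ∩ ∁ C) x y
        new y with y ≟ᶠ x
        ... | yes refl rewrite v~x | a-irr x with S x | does (x ≟ᶠ v)
        ...   | true  | true  = refl
        ...   | true  | false = refl
        ...   | false | _     = refl
        new y | no _ with S y | does (y ≟ᶠ v) | a v y | a x y
        ...   | true  | true  | _     | true  = refl
        ...   | true  | true  | _     | false = refl
        ...   | true  | false | true  | true  = refl
        ...   | true  | false | true  | false = refl
        ...   | true  | false | false | true  = refl
        ...   | true  | false | false | false = refl
        ...   | false | _     | _     | _     = refl
        |A| : count A ≡ 9 + M
        |A| = trans (count-∩ʳ C⊆A) (trans (cong₂ _+_ (trans (count-closed S v v∈S) (cong suc deg≡))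
                                                     (trans (count-cong new) rest≡1)) (+-comm (8 + M) 1))
        bound : ∀ y → A y ≡ true → deg a S y + deg a (S ∩ ∁ A) y ≤ 8 + M
        bound y e with ∧⁻ {S y} e
        ... | Sy , e′ = go (closedNbhd a v y) refl
          where
          go : ∀ b → closedNbhd a v y ≡ b → deg a S y + deg a (S ∩ ∁ A) y ≤ 8 + M
          go true  c = near A v C⊆A v∈S v-centre y (∧⁺ Sy c)
          go false c = near A x X⊆A Sx x-centre y (∧⁺ Sy (trans (sym (cong (_∨ closedNbhd a x y) c)) e′))

    -- A ball of N - 1 vertices must gain N - 1 to match K_{N-1}, hence a charge of at most N - 2
    -- per vertex; `near-centre` gives only N - 1. A vertex attaining N - 1 leads to `double-ball`.
    ball₂ : ∀ v → S v ≡ true → deg a S v ≡ 7 + M → (∀ x → S x ≡ true → deg a S x ≤ 7 + M) →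
            ∃[ A ] A v ≡ true × (Claim (S ∩ ∁ A) → Claim S)
    ball₂ v v∈S deg≡ Δ≤
      with any? (λ x → (closed S v x ≟ᵇ true) ×-dec (8 + M ≤? deg a S x + deg a (S ∩ ∁ closed S v) x))
    ... | yes (x , x∈ , bad) = double-ball v x v∈S deg≡ Δ≤ x∈ bad
    ... | no  ∄ = closed S v , v∈closed S v v∈S
      , extend-periodic S (closed S v) (7 + M) (λ x e → proj₁ (∧⁻ {S x} e))
          (0 , count (closed S v) , 1 , refl
            , trans (cong (_+ 1) |A|) (+-comm (8 + M) 1) , ≤-reflexive (*-identityʳ _))
          (λ x x∈ → ≤-pred (≰⇒> (λ h → ∄ (x , x∈ , h))))
          (≤-reflexive (ring (count (closed S v)) M))
      where
      |A| : count (closed S v) ≡ 8 + M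
      |A| = trans (count-closed S v v∈S) (cong suc deg≡)
      ring : ∀ c M → c * (7 + M) + c ≡ c * (8 + M)
      ring = solve-∀

    small : count S ≤ 9 + M → Claim S
    small |S|≤ = count S , 0 , c * c′ , 0 , sym (+-identityʳ c) , (0 , c , c′ , refl , c+c′ , ≤-refl) , inj₁ refl
      , +-cancelʳ-≤ c _ _ (begin
          arcs S S + (c * c′ + 0) + c   ≡⟨ ring₁ (arcs S S) (c * c′) c ⟩
          arcs S S + c * 1 + c * c′     ≡⟨ cong (_+ c * c′) (trans (cong (arcs S S +_) (sym (sumOn-const S 1)))
                                                                   (sym (sumOn-+ S (deg a S) (λ _ → 1)))) ⟩
          sumOn S (λ x → deg a S x + 1) + c * c′ ≤⟨ +-monoˡ-≤ (c * c′) (sumOn-≤ S c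
                                             (λ x Sx → ≤-trans (≤-reflexive (+-comm _ 1)) (deg≤ S x Sx))) ⟩
          c * c + c * c′                ≡⟨ sym (*-distribˡ-+ c c c′) ⟩
          c * (c + c′)                  ≡⟨ cong (c *_) c+c′ ⟩
          c * (9 + M)                   ≡⟨ ring₂ c M ⟩
          c * (8 + M) + c               ∎)
      where
      open ≤-Reasoning
      c c′ : ℕ
      c  = count S
      c′ = proj₁ (≤⇒∃ |S|≤)
      c+c′ : c + c′ ≡ 9 + M
      c+c′ = proj₂ (≤⇒∃ |S|≤)
      ring₁ : ∀ e d c → e + (d + 0) + c ≡ e + c * 1 + d
      ring₁ = solve-∀
      ring₂ : ∀ c M → c * (9 + M) ≡ c * (8 + M) + c
      ring₂ = solve-∀

    -- Maximal degree at most N - 3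

    surplus : ∀ Q c X → (∀ x → S x ≡ true → deg a S x + ⟦ Q x ⟧ * c ≤ 6 + M) → X ≤ count (S ∩ Q) * c →
              arcs S S + X ≤ count S * (6 + M)
    surplus Q c X h X≤ = begin
      arcs S S + X                               ≤⟨ +-monoʳ-≤ (arcs S S) X≤ ⟩
      arcs S S + count (S ∩ Q) * c               ≡⟨ cong (arcs S S +_) (sym (sumOn-indicator S Q c)) ⟩
      arcs S S + sumOn S (λ x → ⟦ Q x ⟧ * c)     ≡⟨ sym (sumOn-+ S (deg a S) (λ x → ⟦ Q x ⟧ * c)) ⟩
      sumOn S (λ x → deg a S x + ⟦ Q x ⟧ * c)    ≤⟨ sumOn-≤ S (6 + M) h ⟩
      count S * (6 + M)                          ∎
      where open ≤-Reasoning

    module _ (Δ≤ : ∀ x → S x ≡ true → deg a S x ≤ 6 + M) where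

      centre : ∀ x → 6 + M ≤ deg a S x → 9 + M ≤ deg a S x + 3
      centre x h = ≤-trans (≤-reflexive (+-comm 3 (6 + M))) (+-monoˡ-≤ 3 h)

      surplus₁ : ∀ Q X → (∀ x → S x ≡ true → Q x ≡ true → deg a S x < 6 + M) → X ≤ count (S ∩ Q) →
                 arcs S S + X ≤ count S * (6 + M)
      surplus₁ Q X h X≤ = surplus Q 1 X pt (≤-trans X≤ (≤-reflexive (sym (*-identityʳ _))))
        where
        pt : ∀ x → S x ≡ true → deg a S x + ⟦ Q x ⟧ * 1 ≤ 6 + M
        pt x Sx with Q x in eq
        ... | true  = ≤-trans (≤-reflexive (+-comm _ 1)) (h x Sx eq)
        ... | false = ≤-trans (≤-reflexive (+-identityʳ _)) (Δ≤ x Sx)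

      few-out : ∀ u x → S u ≡ true → 6 + M ≤ deg a S u → a u x ≡ true → out a S u x ≤ 2
      few-out u x Su u-centre u~x with few-outside S u x 3 ≤-refl Su u~x (centre u u-centre)
      ... | inj₁ (_ , o≤) = o≤
      ... | inj₂ o<       = ≤-pred o<

      -- A vertex in both balls has at most two neighbours outside each of them, so its degree
      -- is at most i + 3, where i is the size of the intersection.
      two-centres : ∀ v w → S v ≡ true → S w ≡ true → 6 + M ≤ deg a S v → 6 + M ≤ deg a S w →
        closed S v w ≡ false → 1 ≤ deg a (closed S v) w → deg a (closed S v) w ≤ 2 + M →
        arcs S S + (2 + M) ≤ count S * (6 + M)
      two-centres v w Sv Sw v-centre w-centre w∉ 1≤i i≤ =
        surplus Q (suc c) (2 + M) pt
          (≤-trans (product i c 1≤i i+c) (*-monoˡ-≤ (suc c) (count-mono {A = Q} {S ∩ Q} Q⊆)))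
        where
        open ≤-Reasoning
        T Q : Subset p
        T = closed S v
        Q = nbhd a T w
        i c : ℕ
        i = deg a T w
        c = proj₁ (≤⇒∃ i≤)
        i+c : i + c ≡ 2 + M
        i+c = proj₂ (≤⇒∃ i≤)
        -- The i common vertices lack c + 1 each; as i ≥ 1, the product is at least i + c.
        product : ∀ i c → 1 ≤ i → i + c ≡ 2 + M → 2 + M ≤ i * suc c
        product (suc j) c _ e = subst (_≤ suc j * suc c) e (≤-by (j * c) (ring j c))
          where
          ring : ∀ j c → suc j + c + j * c ≡ suc j * suc c
          ring = solve-∀
        Q⊆ : ∀ x → Q x ≡ true → (S ∩ Q) x ≡ true
        Q⊆ x e = ∧⁺ (proj₁ (∧⁻ {S x} (proj₁ (∧⁻ {T x} e)))) e
        v-out : ∀ x → T x ≡ true → a w x ≡ true → out a S v x ≤ 2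
        v-out x Tx w~x with closed⁻ S v x Tx
        ... | _ , inj₂ v~x  = few-out v x Sv v-centre v~x
        ... | _ , inj₁ refl = contradiction (trans (sym (∧⁺ Sw v~w)) w∉) λ ()
          where
          v~w : closedNbhd a v w ≡ true
          v~w with does (w ≟ᶠ v)
          ... | true  = refl
          ... | false = trans (a-sym v w) w~x
        cover : ∀ x → Q x ≡ true → ∀ y →
          ⟦ closed S x y ⟧ ≤ ⟦ Q y ⟧ + ⟦ (nbhd a S x ∩ ∁ closedNbhd a v) y ⟧ + ⟦ (nbhd a S x ∩ ∁ closedNbhd a w) y ⟧
        cover x Qx y with y ≟ᶠ x
        ... | yes refl rewrite Qx = ≤-trans (≤-⟦⟧ (S x ∧ true)) (s≤s z≤n)
          where
          ≤-⟦⟧ : ∀ b → ⟦ b ⟧ ≤ 1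
          ≤-⟦⟧ true  = ≤-refl
          ≤-⟦⟧ false = z≤n
        ... | no _ with y ≟ᶠ w
        -- `w` belongs to its own ball but not to that of `v`, so it counts as outside the latter.
        ...   | yes refl = go w∉
          where
          go : S y ∧ closedNbhd a v y ≡ false →
               ⟦ S y ∧ a x y ⟧ ≤ ⟦ Q y ⟧ + ⟦ (S y ∧ a x y) ∧ not (closedNbhd a v y) ⟧ + ⟦ (S y ∧ a x y) ∧ false ⟧
          go e with S y | a x y | closedNbhd a v y
          ... | false | _     | _     = z≤n
          ... | true  | false | _     = z≤n
          ... | true  | true  | false = s≤s z≤n
        ...   | no  _ with S y | a x y | closedNbhd a v y | a w y
        ...     | false | _     | _     | _     = z≤n
        ...     | true  | false | _     | _     = z≤n
        ...     | true  | true  | false | _     = s≤s z≤n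
        ...     | true  | true  | true  | true  = s≤s z≤n
        ...     | true  | true  | true  | false = s≤s z≤n
        Q-deg : ∀ x → Q x ≡ true → deg a S x ≤ i + 3
        Q-deg x Qx with ∧⁻ {T x} Qx
        ... | Tx , w~x = ≤-pred (begin
          suc (deg a S x)                  ≡⟨ sym (count-closed S x (proj₁ (∧⁻ {S x} Tx))) ⟩
          count (closed S x)               ≤⟨ sum-mono (cover x Qx) ⟩
          _                                ≡⟨ trans (∑-distrib-+ (λ y → ⟦ Q y ⟧ + ⟦ (nbhd a S x ∩ ∁ closedNbhd a v) y ⟧)
                                                                  (λ y → ⟦ (nbhd a S x ∩ ∁ closedNbhd a w) y ⟧))
                                                    (cong (_+ out a S w x) (∑-distrib-+ (λ y → ⟦ Q y ⟧) (λ y → ⟦ (nbhd a S x ∩ ∁ closedNbhd a v) y ⟧))) ⟩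
          i + out a S v x + out a S w x    ≤⟨ +-mono-≤ (+-monoʳ-≤ i (v-out x Tx w~x)) (few-out w x Sw w-centre w~x) ⟩
          i + 2 + 2                        ≡⟨ ring i ⟩
          suc (i + 3)                      ∎)
          where
          ring : ∀ i → i + 2 + 2 ≡ suc (i + 3)
          ring = solve-∀
        pt : ∀ x → S x ≡ true → deg a S x + ⟦ Q x ⟧ * suc c ≤ 6 + M
        pt x Sx with Q x in eq
        ... | false = ≤-trans (≤-reflexive (+-identityʳ _)) (Δ≤ x Sx)
        ... | true  = begin
          deg a S x + (suc c + 0) ≤⟨ +-monoˡ-≤ _ (Q-deg x eq) ⟩
          i + 3 + (suc c + 0)     ≡⟨ ring i c ⟩
          4 + (i + c)             ≡⟨ cong (4 +_) i+c ⟩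
          6 + M                   ∎
          where
          ring : ∀ i c → i + 3 + (suc c + 0) ≡ 4 + (i + c)
          ring = solve-∀

      -- Here 1 + m = N - 15. Around a vertex `v` of degree N - 3, the ball `T` has N - 2 vertices
      -- and leaves N - 3 in `R`. Either some vertex of degree N - 3 in `R` has at most N - 7
      -- neighbours in `T`, which suits `two-centres`, or double counting shows that such vertices
      -- are rare and the rest of `R` falls short by one each.
      exceptional : count S ≡ 13 + 2 * M → ∀ m → M ≡ 7 + m → arcs S S + (1 + m) ≤ count S * (6 + M)
      exceptional |S| m refl with any? (λ v → (S v ≟ᵇ true) ×-dec (6 + M ≤? deg a S v))
      ... | no ∄ = surplus₁ (λ _ → true) (1 + m) (λ x Sx _ → ≰⇒> (λ h → ∄ (x , Sx , h)))
                     (≤-trans (≤-by (26 + m) (ring m)) (≤-reflexive (sym (trans (count-cong ∧-true) |S|))))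
        where
        ∧-true : ∀ x → S x ∧ true ≡ S x
        ∧-true x with S x
        ... | true  = refl
        ... | false = refl
        ring : ∀ m → 1 + m + (26 + m) ≡ 13 + 2 * (7 + m)
        ring = solve-∀
      ... | yes (v , Sv , v-centre) = split (any? (λ w → (R w ≟ᵇ true) ×-dec ((6 + M ≤? deg a S w) ×-dec (deg a T w ≤? 2 + M))))
        where
        open ≤-Reasoning
        T R Z : Subset p
        T = closed S v
        R = S ∩ ∁ T
        Z x = R x ∧ does (6 + M ≤? deg a S x)
        T⊆S : T ⊆ S
        T⊆S x e = proj₁ (∧⁻ {S x} e)
        |T| : count T ≡ 7 + M
        |T| = trans (count-closed S v Sv) (cong suc (≤-antisym (Δ≤ v Sv) v-centre))
        |R| : count R ≡ 6 + M
        |R| = +-cancelˡ-≡ (7 + M) _ _ (trans (cong (_+ count R) (sym |T|))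
                (trans (sym (count-∩ʳ T⊆S)) (trans |S| (ring M))))
          where
          ring : ∀ M → 13 + 2 * M ≡ 7 + M + (6 + M)
          ring = solve-∀
        not⁻ : ∀ {b} → not b ≡ true → b ≡ false
        not⁻ {false} refl = refl
        split : Dec (∃[ w ] R w ≡ true × 6 + M ≤ deg a S w × deg a T w ≤ 2 + M) →
                arcs S S + (1 + m) ≤ count S * (6 + M)
        split (yes (w , Rw , w-centre , i≤)) with ∧⁻ {S w} Rw
        ... | Sw , ¬Tw = ≤-trans (+-monoʳ-≤ (arcs S S) (+-monoˡ-≤ m (m≤m+n 1 8)))
              (two-centres v w Sv Sw v-centre w-centre (not⁻ ¬Tw)
                -- Since |R| = N - 3, a vertex of degree N - 3 in `R` needs a neighbour in `T`.
                (+-cancelʳ-≤ (deg a R w) _ _ (begin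
                  1 + deg a R w           ≤⟨ deg≤ R w Rw ⟩
                  count R                 ≡⟨ |R| ⟩
                  6 + M                   ≤⟨ w-centre ⟩
                  deg a S w               ≡⟨ trans (count-split (nbhd a S w) T) (cong₂ _+_ (count-cong inT) (count-cong inR)) ⟩
                  deg a T w + deg a R w   ∎)) i≤)
          where
          inT : ∀ y → (nbhd a S w ∩ T) y ≡ nbhd a T w y
          inT y with S y | a w y | closedNbhd a v y
          ... | true  | true  | true  = refl
          ... | true  | true  | false = refl
          ... | true  | false | true  = refl
          ... | true  | false | false = refl
          ... | false | _     | _     = refl
          inR : ∀ y → (nbhd a S w ∩ ∁ T) y ≡ nbhd a R w y
          inR y with S y | a w y | closedNbhd a v y
          ... | true  | true  | true  = refl
          ... | true  | true  | false = refl
          ... | true  | false | true  = refl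
          ... | true  | false | false = refl
          ... | false | _     | _     = refl
        split (no ∄) = surplus₁ (R ∩ ∁ Z) (1 + m) Q-deg (≤-trans many (count-mono {A = R ∩ ∁ Z} {S ∩ (R ∩ ∁ Z)} Q⊆))
          where
          Q⊆ : ∀ x → (R ∩ ∁ Z) x ≡ true → (S ∩ (R ∩ ∁ Z)) x ≡ true
          Q⊆ x e = ∧⁺ (proj₁ (∧⁻ {S x} (proj₁ (∧⁻ {R x} e)))) e
          Q-deg : ∀ x → S x ≡ true → (R ∩ ∁ Z) x ≡ true → deg a S x < 6 + M
          Q-deg x _ e with ∧⁻ {R x} e
          ... | Rx , ¬Zx = ≰⇒> (λ h → contradiction (trans (sym ¬Zx)
                             (cong not (∧⁺ Rx (dec-true (6 + M ≤? deg a S x) h)))) λ ())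
          T-out : ∀ x → T x ≡ true → deg a Z x ≤ 2
          T-out x Tx with closed⁻ S v x Tx
          ... | _ , c = ≤-trans (count-mono {A = nbhd a Z x} {nbhd a R x}
                                  (λ y e → ∧⁺ (proj₁ (∧⁻ {R y} (proj₁ (∧⁻ {Z y} e)))) (proj₂ (∧⁻ {Z y} e)))) (go c)
            where
            go : x ≡ v ⊎ a v x ≡ true → deg a R x ≤ 2
            go (inj₁ refl) = ≤-trans (≤-reflexive (deg-rest-centre S T v (λ _ e → e))) z≤n
            go (inj₂ v~x)  = ≤-trans (deg-rest≤out S T v x (λ _ e → e)) (few-out v x Sv v-centre v~x)
          Z-deg : ∀ w → Z w ≡ true → 3 + M ≤ deg a T w
          Z-deg w Zw with ∧⁻ {R w} Zw
          ... | Rw , h = ≰⇒> (λ i≤ → ∄ (w , Rw , does⁻ (6 + M ≤? deg a S w) h , i≤))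
          double-count : count Z * (3 + M) ≤ (7 + M) * 2
          double-count = begin
            count Z * (3 + M)       ≡⟨ sym (sumOn-const Z (3 + M)) ⟩
            sumOn Z (λ _ → 3 + M)   ≤⟨ sumOn-mono Z Z-deg ⟩
            arcs Z T                ≡⟨ arcs-comm Z T ⟩
            arcs T Z                ≤⟨ sumOn-≤ T 2 T-out ⟩
            count T * 2             ≡⟨ cong (_* 2) |T| ⟩
            (7 + M) * 2             ∎
          -- A crude bound, but 12 is what can be spared: (N - 3) - 12 = N - 15.
          |Z|≤12 : count Z ≤ 12
          |Z|≤12 = ≮⇒≥ λ 13≤ → <-irrefl refl (begin
            suc ((7 + M) * 2)           ≤⟨ ≤-by (24 + 11 * M) (ring M) ⟩
            13 * (3 + M)                ≤⟨ *-monoˡ-≤ (3 + M) {13} {count Z} 13≤ ⟩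
            count Z * (3 + M)           ≤⟨ double-count ⟩
            (7 + M) * 2                 ∎)
            where
            ring : ∀ M → suc ((7 + M) * 2) + (24 + 11 * M) ≡ 13 * (3 + M)
            ring = solve-∀
          many : 1 + m ≤ count (R ∩ ∁ Z)
          many = +-cancelˡ-≤ 12 _ _ (begin
            12 + (1 + m)                 ≡⟨ sym |R| ⟩
            count R                      ≡⟨ count-∩ʳ {A = Z} (λ x e → proj₁ (∧⁻ {R x} e)) ⟩
            count Z + count (R ∩ ∁ Z)    ≤⟨ +-monoˡ-≤ _ |Z|≤12 ⟩
            12 + count (R ∩ ∁ Z)         ∎)

      loose : 9 + M ≤ count S → Claim S
      loose N≤ = 0 , count S , 0 , 2 * count S ⊔ x , refl , Periodic-0
        -- One value of `l` must satisfy both demands of `Loose`, hence the maximum; `x` is 5 (N -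
        -- 5) at the exceptional size and 0 otherwise.
        , inj₂ (N≤ , m≤m⊔n _ x , λ e → ≤-trans (≤-reflexive (sym (x≡ e))) (m≤n⊔m (2 * count S) x))
        , (begin
            arcs S S + (2 * count S ⊔ x)              ≡⟨ +-distribˡ-⊔ (arcs S S) (2 * count S) x ⟩
            (arcs S S + 2 * count S) ⊔ (arcs S S + x) ≤⟨ ⊔-lub deg-bound x-bound ⟩
            count S * (8 + M)                         ∎)
        where
        open ≤-Reasoning
        x : ℕ
        x with count S ≟ 13 + 2 * M
        ... | yes _ = 5 * (4 + M)
        ... | no  _ = 0
        x≡ : count S ≡ 13 + 2 * M → x ≡ 5 * (4 + M)
        x≡ e with count S ≟ 13 + 2 * M
        ... | yes _ = refl
        ... | no ≢  = contradiction e ≢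
        deg-bound : arcs S S + 2 * count S ≤ count S * (8 + M)
        deg-bound = begin
          arcs S S + 2 * count S            ≤⟨ +-monoˡ-≤ _ (sumOn-≤ S (6 + M) Δ≤) ⟩
          count S * (6 + M) + 2 * count S   ≡⟨ ring (count S) M ⟩
          count S * (8 + M)                 ∎
          where
          ring : ∀ c M → c * (6 + M) + 2 * c ≡ c * (8 + M)
          ring = solve-∀
        special : count S ≡ 13 + 2 * M → Dec (7 ≤ M) → arcs S S + 5 * (4 + M) ≤ count S * (8 + M)
        -- For N ≤ 15, 2 (2N - 5) already reaches 5 (N - 5).
        special e (no 7≰M) = ≤-trans (+-monoʳ-≤ (arcs S S) (begin
            5 * (4 + M)           ≡⟨ ring₁ M ⟩
            20 + 4 * M + M        ≤⟨ +-monoʳ-≤ (20 + 4 * M) (≤-pred (≰⇒> 7≰M)) ⟩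
            20 + 4 * M + 6        ≡⟨ ring₂ M ⟩
            2 * (13 + 2 * M)      ≡⟨ cong (2 *_) (sym e) ⟩
            2 * count S           ∎)) deg-bound
          where
          ring₁ : ∀ M → 5 * (4 + M) ≡ 20 + 4 * M + M
          ring₁ = solve-∀
          ring₂ : ∀ M → 20 + 4 * M + 6 ≡ 2 * (13 + 2 * M)
          ring₂ = solve-∀
        special e (yes 7≤M) = begin
            arcs S S + 5 * (4 + M)                 ≡⟨ cong (arcs S S +_) five ⟩
            arcs S S + ((1 + m) + 2 * count S)     ≡⟨ sym (+-assoc (arcs S S) (1 + m) _) ⟩
            arcs S S + (1 + m) + 2 * count S       ≤⟨ +-monoˡ-≤ _ (exceptional e m (sym M≡)) ⟩
            count S * (6 + M) + 2 * count S        ≡⟨ ring (count S) M ⟩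
            count S * (8 + M)                      ∎
          where
          m = proj₁ (≤⇒∃ 7≤M)
          M≡ : 7 + m ≡ M
          M≡ = proj₂ (≤⇒∃ 7≤M)
          ring : ∀ c M → c * (6 + M) + 2 * c ≡ c * (8 + M)
          ring = solve-∀
          ring₁ : ∀ m → 5 * (4 + (7 + m)) ≡ (1 + m) + 2 * (13 + 2 * (7 + m))
          ring₁ = solve-∀
          five : 5 * (4 + M) ≡ (1 + m) + 2 * count S
          five = trans (cong (λ t → 5 * (4 + t)) (sym M≡)) (trans (ring₁ m)
                   (cong (λ t → (1 + m) + 2 * t) (trans (cong (λ t → 13 + 2 * t) M≡) (sym e))))
        x-bound : arcs S S + x ≤ count S * (8 + M)
        x-bound with count S ≟ 13 + 2 * M
        ... | yes e = special e (7 ≤? M)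
        ... | no  _ = ≤-trans (+-monoʳ-≤ (arcs S S) z≤n) deg-bound

    step : Claim S ⊎ ∃[ v ] S v ≡ true × ∃[ A ] A v ≡ true × (Claim (S ∩ ∁ A) → Claim S)
    step with any? (λ v → (S v ≟ᵇ true) ×-dec (9 + M ≤? deg a S v))
    ... | yes (v , Sv , h) = inj₂ (v , Sv , star v Sv h)
    ... | no ∄₉ with any? (λ v → (S v ≟ᵇ true) ×-dec (8 + M ≤? deg a S v))
    ...   | yes (v , Sv , h) = inj₂ (v , Sv , ball v Sv (≤-antisym (Δ₈ v Sv) h) Δ₈)
      where
      Δ₈ : ∀ x → S x ≡ true → deg a S x ≤ 8 + M
      Δ₈ x Sx = ≤-pred (≰⇒> (λ h → ∄₉ (x , Sx , h)))
    ...   | no ∄₈ with any? (λ v → (S v ≟ᵇ true) ×-dec (7 + M ≤? deg a S v))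
    ...     | yes (v , Sv , h) = inj₂ (v , Sv , ball₂ v Sv (≤-antisym (Δ₇ v Sv) h) Δ₇)
      where
      Δ₇ : ∀ x → S x ≡ true → deg a S x ≤ 7 + M
      Δ₇ x Sx = ≤-pred (≰⇒> (λ h → ∄₈ (x , Sx , h)))
    ...     | no ∄₇ with ≤-total (count S) (9 + M)
    ...       | inj₁ |S|≤ = inj₁ (small |S|≤)
    ...       | inj₂ |S|≥ = inj₁ (loose (λ x Sx → ≤-pred (≰⇒> (λ h → ∄₇ (x , Sx , h)))) |S|≥)

  claim : ∀ S → Claim S
  claim S = <-rec (λ n → ∀ S → count S ≡ n → Claim S) go (count S) S refl
    where
    go : ∀ n → (∀ {m} → m < n → ∀ S → count S ≡ m → Claim S) → ∀ S → count S ≡ n → Claim S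
    go n rec S refl with step S
    ... | inj₁ c = c
    ... | inj₂ (v , Sv , A , Av , extend) = extend (rec smaller (S ∩ ∁ A) refl)
      where
      smaller : count (S ∩ ∁ A) < count S
      smaller = ≤-trans (+-monoˡ-≤ _ (∃⇒count (S ∩ A) v (∧⁺ Sv Av))) (≤-reflexive (sym (count-split S A)))

  arcs-bound : ∀ k S → count S ≡ k * (9 + M) + (4 + M) → arcs S S + 5 * (4 + M) ≤ count S * (8 + M)
  arcs-bound k S e with claim S
  ... | q , s , d , l , |S| , P , L , ≤S =
    ≤-trans (+-monoʳ-≤ (arcs S S) (deficit-bound {k = k} P L (trans (sym |S|) e))) ≤S

-- Disjoint unions of cliques

module _ {A B : Set} {P : Pred (A × B) 0ℓ} (P? : Decidable P) where

  length-filter-row : ∀ x {n} (g : Fin n → B) →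
    length (filter P? (map (x ,_) (tabulate g))) ≡ sum (λ j → ⟦ does (P? (x , g j)) ⟧)
  length-filter-row x {zero}  g = refl
  length-filter-row x {suc n} g with does (P? (x , g zero))
  ... | true  = cong suc (length-filter-row x (g ∘ suc))
  ... | false = length-filter-row x (g ∘ suc)

  length-filter-product : ∀ {m n} (f : Fin m → A) (g : Fin n → B) →
    length (filter P? (cartesianProduct (tabulate f) (tabulate g))) ≡
    sum (λ i → sum (λ j → ⟦ does (P? (f i , g j)) ⟧))
  length-filter-product {zero}  f g = refl
  length-filter-product {suc m} f g = trans
    (cong length (filter-++ P? (map (f zero ,_) (tabulate g)) _))
    (trans (length-++ (filter P? (map (f zero ,_) (tabulate g))))
           (cong₂ _+_ (length-filter-row (f zero) g) (length-filter-product (f ∘ suc) g)))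

module _ {p : ℕ} (G : Graph p) where
  open Graph G

  adj-sym : ∀ x y → adj G x y ≡ adj G y x
  adj-sym x y with x ~? y | y ~? x
  ... | yes _ | yes _ = refl
  ... | no  _ | no  _ = refl
  ... | yes h | no ¬h = contradiction (~-sym h) ¬h
  ... | no ¬h | yes h = contradiction (~-sym h) ¬h

  adj-irrefl : ∀ x → adj G x x ≡ false
  adj-irrefl x = dec-false (x ~? x) (~-irrefl refl)

  open Peeling (adj G) adj-sym adj-irrefl

  e-∑ : e G ≡ sum (λ i → sum (λ j → ⟦ does (i <ᶠ? j) ∧ adj G i j ⟧))
  e-∑ = length-filter-product (λ (i , j) → (i <ᶠ? j) ×-dec (i ~? j)) id id

  handshake : arcs (λ _ → true) (λ _ → true) ≡ 2 * e G
  handshake = begin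
    arcs (λ _ → true) (λ _ → true)                             ≡⟨ arcs-∑ _ _ ⟩
    sum (λ i → sum (λ j → ⟦ adj G i j ⟧))                      ≡⟨ sum-cong-≗ (λ i → trans (sum-cong-≗ (pt i)) (∑-distrib-+ (f i) (λ j → f j i))) ⟩
    sum (λ i → sum (f i) + sum (λ j → f j i))                  ≡⟨ ∑-distrib-+ (λ i → sum (f i)) (λ i → sum (λ j → f j i)) ⟩
    sum (λ i → sum (f i)) + sum (λ i → sum (λ j → f j i))      ≡⟨ cong (sum (λ i → sum (f i)) +_) (∑-comm (λ i j → f j i)) ⟩
    sum (λ i → sum (f i)) + sum (λ i → sum (f i))              ≡⟨ cong₂ _+_ (sym e-∑) (trans (sym e-∑) (sym (+-identityʳ _))) ⟩
    2 * e G                                                    ∎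
    where
    open ≡-Reasoning
    f : Fin p → Fin p → ℕ
    f i j = ⟦ does (i <ᶠ? j) ∧ adj G i j ⟧
    pt : ∀ i j → ⟦ adj G i j ⟧ ≡ f i j + f j i
    pt i j with <ᶠ-cmp i j
    ... | tri< i<j _ j≮i rewrite dec-true (i <ᶠ? j) i<j | dec-false (j <ᶠ? i) j≮i = sym (+-identityʳ _)
    ... | tri> i≮j _ j<i rewrite dec-true (j <ᶠ? i) j<i | dec-false (i <ᶠ? j) i≮j | adj-sym i j = refl
    ... | tri≈ i≮i refl _ rewrite dec-false (i <ᶠ? i) i≮i | adj-irrefl i = refl

-- Edge count of the clique union

∑ℕ : (ℕ → ℕ) → ℕ → ℕ
∑ℕ f n = sum {n} (f ∘ toℕ)

∑ℕ-+ : ∀ f a b → ∑ℕ f (a + b) ≡ ∑ℕ f a + ∑ℕ (f ∘ (a +_)) b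
∑ℕ-+ f zero    b = refl
∑ℕ-+ f (suc a) b = trans (cong (f 0 +_) (∑ℕ-+ (f ∘ suc) a b)) (sym (+-assoc (f 0) _ _))

module _ (N : ℕ) .{{_ : NonZero N}} where

  -- The disjoint union of cliques on the intervals [bN , (b+1)N) ∩ [0 , p).
  cliques : ∀ p → Graph p
  cliques p = record
    { _~_      = λ i j → i ≢ j × toℕ i / N ≡ toℕ j / N
    ; ~-sym    = λ (≢ , ≡) → ≢ ∘ sym , sym ≡
    ; ~-irrefl = λ ≡ (≢ , _) → ≢ ≡
    ; _~?_     = λ i j → ¬? (i ≟ᶠ j) ×-dec (toℕ i / N ≟ toℕ j / N)
    }

  block : ∀ b t → t < N → (b * N + t) / N ≡ b
  block b t t<N = trans (+-distrib-/-∣ˡ t (n∣m*n b))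
    (trans (cong₂ _+_ (m*n/n≡m b N) (m<n⇒m/n≡0 t<N)) (+-identityʳ b))

  -- The earlier vertices of the interval of `j` are all neighbours. Counting each edge at its
  -- larger end turns the edge count into a sum of residues, which also handles the last, incomplete
  -- interval.
  down-degree : ∀ {p} (j : Fin p) → toℕ j % N ≤ sum (λ i → ⟦ does (i <ᶠ? j) ∧ adj (cliques p) i j ⟧)
  down-degree {p} j = begin
    r                                        ≡⟨ sym (count-full r) ⟩
    ∑ℕ (λ _ → 1) r                           ≤⟨ sum-mono (λ t → ≤-reflexive (sym (one t))) ⟩
    ∑ℕ (F ∘ (b * N +_)) r                    ≤⟨ m≤n+m _ _ ⟩
    ∑ℕ F (b * N) + ∑ℕ (F ∘ (b * N +_)) r     ≡⟨ sym (∑ℕ-+ F (b * N) r) ⟩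
    ∑ℕ F (b * N + r)                         ≤⟨ m≤m+n _ _ ⟩
    ∑ℕ F (b * N + r) + _                     ≡⟨ sym (∑ℕ-+ F (b * N + r) _) ⟩
    ∑ℕ F (b * N + r + proj₁ j≤p)             ≡⟨ cong (∑ℕ F) (proj₂ j≤p) ⟩
    ∑ℕ F p                                   ≤⟨ sum-mono pt ⟩
    sum (λ i → ⟦ does (i <ᶠ? j) ∧ adj (cliques p) i j ⟧) ∎
    where
    open ≤-Reasoning
    r b : ℕ
    r = toℕ j % N
    b = toℕ j / N
    j≡ : toℕ j ≡ b * N + r
    j≡ = trans (m≡m%n+[m/n]*n (toℕ j) N) (+-comm r (b * N))
    -- Since i < j implies i ≢ j, adjacency becomes a condition on natural numbers, and the sum can
    -- be cut into intervals.
    F : ℕ → ℕ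
    F i = ⟦ does (i <? toℕ j) ∧ does (i / N ≟ toℕ j / N) ⟧
    j≤p = ≤⇒∃ (≤-trans (≤-reflexive (sym j≡)) (<⇒≤ (toℕ<n j)))
    one : ∀ (t : Fin r) → F (b * N + toℕ t) ≡ 1
    one t = cong ⟦_⟧ (∧⁺
      (dec-true (b * N + toℕ t <? toℕ j) (subst (b * N + toℕ t <_) (sym j≡) (+-monoʳ-< (b * N) (toℕ<n t))))
      (dec-true ((b * N + toℕ t) / N ≟ toℕ j / N) (block b (toℕ t) (<-trans (toℕ<n t) (m%n<n (toℕ j) N)))))
    pt : ∀ i → F (toℕ i) ≤ ⟦ does (i <ᶠ? j) ∧ adj (cliques p) i j ⟧
    pt i with i ≟ᶠ j
    ... | no  _    = ≤-refl
    ... | yes refl rewrite dec-false (toℕ i <? toℕ i) (<-irrefl refl) = z≤n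

  ∑-residues : ∀ q → q ≤ N → 2 * ∑ℕ (_% N) q + q ≡ q * q
  ∑-residues zero    _   = refl
  ∑-residues (suc q) q<N = begin
    2 * ∑ℕ (_% N) (suc q) + suc q                      ≡⟨ cong (λ s → 2 * s + suc q) last ⟩
    2 * (∑ℕ (_% N) q + q) + suc q                      ≡⟨ ring₁ (∑ℕ (_% N) q) q ⟩
    (2 * ∑ℕ (_% N) q + q) + (2 * q + 1)                ≡⟨ cong (_+ (2 * q + 1)) (∑-residues q (<⇒≤ q<N)) ⟩
    q * q + (2 * q + 1)                                ≡⟨ ring₂ q ⟩
    suc q * suc q                                      ∎
    where
    open ≡-Reasoning
    ring₁ : ∀ s q → 2 * (s + q) + suc q ≡ (2 * s + q) + (2 * q + 1)
    ring₁ = solve-∀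
    ring₂ : ∀ q → q * q + (2 * q + 1) ≡ suc q * suc q
    ring₂ = solve-∀
    last : ∑ℕ (_% N) (suc q) ≡ ∑ℕ (_% N) q + q
    last = trans (cong (∑ℕ (_% N)) (+-comm 1 q)) (trans (∑ℕ-+ (_% N) q 1)
             (cong (∑ℕ (_% N) q +_) (trans (+-identityʳ _) (trans (cong (_% N) (+-identityʳ q)) (m<n⇒m%n≡m q<N)))))

  ∑-residues-periodic : ∀ k q → q ≤ N → 2 * ∑ℕ (_% N) (k * N + q) + (k * N + q) ≡ k * (N * N) + q * q
  ∑-residues-periodic zero    q q≤N = ∑-residues q q≤N
  ∑-residues-periodic (suc k) q q≤N = begin
    2 * ∑ℕ (_% N) (N + k * N + q) + (N + k * N + q)      ≡⟨ cong (λ s → 2 * s + (N + k * N + q)) first ⟩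
    2 * (∑ℕ (_% N) N + s) + (N + k * N + q)              ≡⟨ ring (∑ℕ (_% N) N) s N (k * N) q ⟩
    (2 * ∑ℕ (_% N) N + N) + (2 * s + (k * N + q))        ≡⟨ cong₂ _+_ (∑-residues N ≤-refl) (∑-residues-periodic k q q≤N) ⟩
    N * N + (k * (N * N) + q * q)                        ≡⟨ sym (+-assoc (N * N) _ _) ⟩
    suc k * (N * N) + q * q                              ∎
    where
    open ≡-Reasoning
    s = ∑ℕ (_% N) (k * N + q)
    ring : ∀ a s N c q → 2 * (a + s) + (N + c + q) ≡ (2 * a + N) + (2 * s + (c + q))
    ring = solve-∀
    first : ∑ℕ (_% N) (N + k * N + q) ≡ ∑ℕ (_% N) N + s
    first = trans (cong (∑ℕ (_% N)) (+-assoc N (k * N) q)) (trans (∑ℕ-+ (_% N) N (k * N + q))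
      (cong (∑ℕ (_% N) N +_) (sum-cong-≗ {k * N + q} (λ i → trans (cong (_% N) (+-comm N (toℕ i))) ([m+n]%n≡m%n (toℕ i) N)))))

  e-cliques : ∀ k q → q ≤ N → k * (N * N) + q * q ≤ 2 * e (cliques (k * N + q)) + (k * N + q)
  e-cliques k q q≤N = begin
    k * (N * N) + q * q                     ≡⟨ sym (∑-residues-periodic k q q≤N) ⟩
    2 * ∑ℕ (_% N) p + p                     ≤⟨ +-monoˡ-≤ p (*-monoʳ-≤ 2 (sum-mono (down-degree {p}))) ⟩
    2 * sum (λ j → sum (λ i → f i j)) + p   ≡⟨ cong (λ s → 2 * s + p) (trans (∑-comm (λ j i → f i j)) (sym (e-∑ (cliques p)))) ⟩
    2 * e (cliques p) + p                   ∎
    where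
    open ≤-Reasoning
    p = k * N + q
    f : Fin p → Fin p → ℕ
    f i j = ⟦ does (i <ᶠ? j) ∧ adj (cliques p) i j ⟧

-- The tree is connected, so a copy lies in one interval; its N + 1 vertices would then have
-- distinct residues modulo N.
cliques-T³-free : ∀ M {p} (n≥6 : 10 + M ≥ 6) → ¬ Contains (cliques (9 + M) p) (T³ (10 + M) n≥6)
cliques-T³-free M {p} n≥6 (f , f-inj , f-hom) = <-irrefl refl (injective⇒≤ {f = g} g-inj)
  where
  N = 9 + M
  block₀ : Fin (10 + M) → Set
  block₀ i = toℕ (f i) / N ≡ toℕ (f zero) / N
  b₁ : block₀ (suc zero)
  b₁ = sym (proj₂ (f-hom {zero} {suc zero} (inj₁ (v₀v (s≤s z≤n) (s≤s z≤n)))))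
  same : ∀ i → block₀ i
  same zero    = refl
  same (suc i) with suc (toℕ i) ≤? 6 + M
  ... | yes i≤ = sym (proj₂ (f-hom {zero} {suc i} (inj₁ (v₀v (s≤s z≤n) i≤))))
  ... | no  i≰ = trans (sym (proj₂ (f-hom {suc zero} {suc i} (inj₁ (v₁v (≰⇒> i≰) (toℕ<n i)))))) b₁
  g : Fin (10 + M) → Fin N
  g i = fromℕ< (m%n<n (toℕ (f i)) N)
  g-inj : ∀ {i j} → g i ≡ g j → i ≡ j
  g-inj {i} {j} e = f-inj (toℕ-injective (trans (m≡m%n+[m/n]*n (toℕ (f i)) N) (trans
    (cong₂ (λ r q → r + q * N)
      (trans (sym (toℕ-fromℕ< (m%n<n (toℕ (f i)) N))) (trans (cong toℕ e) (toℕ-fromℕ< (m%n<n (toℕ (f j)) N))))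
      (trans (same i) (sym (same j))))
    (sym (m≡m%n+[m/n]*n (toℕ (f j)) N)))))

-- The two bounds meet

upper-bound : ∀ M k (n≥6 : 10 + M ≥ 6) (G : Graph (k * (9 + M) + (4 + M))) → ¬ Contains G (T³ (10 + M) n≥6) →
              2 * e G + 5 * (4 + M) ≤ (8 + M) * (k * (9 + M) + (4 + M))
upper-bound M k n≥6 G free = begin
  2 * e G + 5 * (4 + M)              ≡⟨ cong (_+ 5 * (4 + M)) (sym (handshake G)) ⟩
  _                                  ≤⟨ Upper.arcs-bound M (adj G) (adj-sym G) (adj-irrefl G)
                                          (T³-free⇒ M G n≥6 free) k (λ _ → true) (count-full p) ⟩
  count {p} (λ _ → true) * (8 + M)   ≡⟨ cong (_* (8 + M)) (count-full p) ⟩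
  p * (8 + M)                        ≡⟨ *-comm p (8 + M) ⟩
  (8 + M) * p                        ∎
  where
  open ≤-Reasoning
  p = k * (9 + M) + (4 + M)

-- The edges of the cliques are counted only from below; the other inequality is `upper-bound` for
-- this very graph.
e-cliques-≡ : ∀ M k (n≥6 : 10 + M ≥ 6) →
  2 * e (cliques (9 + M) (k * (9 + M) + (4 + M))) + 5 * (4 + M) ≡ (8 + M) * (k * (9 + M) + (4 + M))
e-cliques-≡ M k n≥6 = ≤-antisym (upper-bound M k n≥6 (cliques (9 + M) (k * (9 + M) + (4 + M))) (cliques-T³-free M n≥6))
  (+-cancelʳ-≤ (k * (9 + M) + (4 + M)) _ _ (begin
    (8 + M) * p + p                              ≡⟨ ring₁ k M ⟩
    k * ((9 + M) * (9 + M)) + (4 + M) * (4 + M) + 5 * (4 + M) ≤⟨ +-monoˡ-≤ _ (e-cliques (9 + M) k (4 + M) (+-monoˡ-≤ M (m≤m+n 4 5))) ⟩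
    2 * e (cliques (9 + M) p) + p + 5 * (4 + M)  ≡⟨ ring₂ (e (cliques (9 + M) p)) p (5 * (4 + M)) ⟩
    2 * e (cliques (9 + M) p) + 5 * (4 + M) + p  ∎))
  where
  open ≤-Reasoning
  p = k * (9 + M) + (4 + M)
  ring₁ : ∀ k M → (8 + M) * (k * (9 + M) + (4 + M)) + (k * (9 + M) + (4 + M)) ≡
                  k * ((9 + M) * (9 + M)) + (4 + M) * (4 + M) + 5 * (4 + M)
  ring₁ = solve-∀
  ring₂ : ∀ e p c → 2 * e + p + c ≡ 2 * e + c + p
  ring₂ = solve-∀

-- The formula over the rationals

open import Data.Integer.Base as ℤ using (+_)
open import Data.Integer.Properties as ℤ using (⊖-≥; m-n≡m⊖n; pos-*)
open import Data.Rational.Base as ℚ using ()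
open import Data.Rational.Unnormalised.Base using (mkℚᵘ; *≡*)
open import Data.Rational.Properties using (fromℚᵘ-cong)

-- Clears the denominator, turning the integer subtraction into an addition of naturals.
half : ∀ m a b c d → 2 * m + c * d ≡ a * b → + m ℚ./ 1 ≡ ((+ a ℤ.* + b) ℤ.- (+ c ℤ.* + d)) ℚ./ 2
half m a b c d eq = fromℚᵘ-cong {mkℚᵘ (+ m) 0} {mkℚᵘ ((+ a ℤ.* + b) ℤ.- (+ c ℤ.* + d)) 1} (*≡* (trans (sym (pos-* m 2)) (trans (cong +_ (*-comm m 2))
  (sym (trans (ℤ.*-identityʳ _) (begin
    (+ a ℤ.* + b) ℤ.- (+ c ℤ.* + d)  ≡⟨ cong₂ ℤ._-_ (sym (pos-* a b)) (sym (pos-* c d)) ⟩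
    + (a * b) ℤ.- + (c * d)          ≡⟨ cong (λ t → + t ℤ.- + (c * d)) (sym eq) ⟩
    + (2 * m + c * d) ℤ.- + (c * d)  ≡⟨ m-n≡m⊖n (2 * m + c * d) (c * d) ⟩
    (2 * m + c * d) ℤ.⊖ (c * d)      ≡⟨ ⊖-≥ (m≤n+m (c * d) (2 * m)) ⟩
    + (2 * m + c * d ∸ c * d)        ≡⟨ cong +_ (m+n∸n≡m (2 * m) (c * d)) ⟩
    + (2 * m)                        ∎))))))
  where open ≡-Reasoning

ex-T³ : ∀ M p k (n≥6 : 10 + M ≥ 6) → p ≡ k * (9 + M) + (4 + M) →
        ∃[ m ] IsEx p (T³ (10 + M) n≥6) m × 2 * m + 5 * (4 + M) ≡ (8 + M) * p
ex-T³ M p k n≥6 refl =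
  e (cliques (9 + M) p)
  , ((cliques (9 + M) p , cliques-T³-free M n≥6 , refl)
    , λ G free → *-cancelˡ-≤ 2 (+-cancelʳ-≤ (5 * (4 + M)) _ _
        (≤-trans (upper-bound M k n≥6 G free) (≤-reflexive (sym (e-cliques-≡ M k n≥6))))))
  , e-cliques-≡ M k n≥6

theorem4p3 : ∀ (p n : ℕ) → p ≥ n → (n≥10 : n ≥ 10) →
    (∃[ k ] k ≥ 1 × p ≡ k * (n ∸ 1) + (n ∸ 6)) →
    ∃[ m ] IsEx p (T³ n (m+n≤o⇒n≤o 4 n≥10)) m ×
    + m ℚ./ 1 ≡ (((+ n ℤ.- + 2) ℤ.* + p) ℤ.- (+ 5 ℤ.* (+ n ℤ.- + 6))) ℚ./ 2
theorem4p3 p n _ n≥10 (k , _ , p≡) = go (proj₁ (≤⇒∃ n≥10)) n (proj₂ (≤⇒∃ n≥10)) n≥10 p≡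
  where
  go : ∀ M n → 10 + M ≡ n → (n≥10 : n ≥ 10) → p ≡ k * (n ∸ 1) + (n ∸ 6) →
       ∃[ m ] IsEx p (T³ n (m+n≤o⇒n≤o 4 n≥10)) m ×
       + m ℚ./ 1 ≡ (((+ n ℤ.- + 2) ℤ.* + p) ℤ.- (+ 5 ℤ.* (+ n ℤ.- + 6))) ℚ./ 2
  -- Once n is 10 + M, the integer differences n - 2 and n - 6 compute to 8 + M and 4 + M, so `half`
  -- fits without rewriting.
  go M _ refl n≥10 p≡ =
    let m , ex , eq = ex-T³ M p k (m+n≤o⇒n≤o 4 n≥10) p≡
    in m , ex , half m (8 + M) p 5 (4 + M) eq
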